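{- Let $p\ge3$ and let $\tau=\tau_1\cdots\tau_p\in S_p$ with $\tau_1=1$, $\tau_p=s$ where $2\le s<p$, and suppose $\tau$ has the minimal overlapping property. Define the polynomials $\mathrm{IU}_{\tau,n}(q,z)$ by \[ 1+\sum_{n\ge1}\mathrm{IU}_{\tau,n}(q,z)\frac{t^n}{[n]_q!}=\frac{1}{\mathrm{INM}_\tau(t,q,z)}, \] and set $\mathrm{IU}_{\tau,0}(q,z)=1$. Then $\mathrm{IU}_{\tau,1}(q,z)=-z$, and for all $n\ge2$, \[ \mathrm{IU}_{\tau,n}(q,z)=(1-z)\,\mathrm{IU}_{\tau,n-1}(q,z)-z^{\mathrm{des}(\tau)}q^{\mathrm{inv}(\tau)}\begin{bmatrix} n-s\\ p-s\end{bmatrix}_q\mathrm{IU}_{\tau,n-p+1}(q,z), \] where the second term is interpreted as $0$ whenever $n<p$ (the $q$-binomial coefficient then vanishes).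
   Context: For $\sigma\in S_n$: $\mathrm{des}(\sigma)=|\{i:\sigma_i>\sigma_{i+1}\}|$, $\mathrm{inv}(\sigma)=|\{(i,k):i<k,\sigma_i>\sigma_k\}|$. $\mathrm{red}(w)$ replaces the $i$-th smallest entry of a sequence of distinct integers by $i$; $\sigma$ has a $\tau$-match at position $i$ if $\mathrm{red}(\sigma_i\cdots\sigma_{i+p-1})=\tau$; $\mathcal{NM}_n(\tau)$ is the set of $\sigma\in S_n$ with no $\tau$-match. $\tau\in S_p$ ($p\ge3$) is minimal overlapping if the smallest $i$ such that some $\sigma\in S_i$ has exactly two $\tau$-matches is $2p-1$. $[n]_q=1+q+\cdots+q^{n-1}$, $[n]_q!=[1]_q\cdots[n]_q$, $[0]_q!=1$, and $\begin{bmatrix} m\\ k\end{bmatrix}_q=\frac{[m]_q!}{[k]_q![m-k]_q!}$ for $0\le k\le m$ and $0$ otherwise. $\mathrm{INM}_{\tau,n}(q,z)=\sum_{\sigma\in\mathcal{NM}_n(\tau)}z^{\mathrm{des}(\sigma)+1}q^{\mathrm{inv}(\sigma)}$ and $\mathrm{INM}_\tau(t,q,z)=1+\sum_{n\ge1}\frac{t^n}{[n]_q!}\mathrm{INM}_{\tau,n}(q,z)$. -}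

module Defs where

open import Data.Nat using (ℕ; zero; suc; _+_; _∸_; _≤_; _<_; _≤?_; _<?_; _≟_)
open import Data.Integer as ℤ using (ℤ; +_; -_)
open import Data.List using (List; []; _∷_; length; filter; foldr; map; concatMap; upTo; take; drop)
open import Data.List.Relation.Unary.All using (All)
open import Data.List.Relation.Unary.Unique.DecPropositional _≟_ using (Unique; unique?)
open import Data.List.Properties using (≡-dec)
open import Data.Product using (_×_; Σ; _,_)
open import Data.Bool using (Bool; true; false; if_then_else_)
open import Relation.Nullary.Decidable using (does; _×-dec_; ¬?)
open import Relation.Binary.PropositionalEquality using (_≡_)

IsPerm : ℕ → List ℕ → Set
IsPerm n σ = (length σ ≡ n) × All (λ x → (1 ≤ x) × (x ≤ n)) σ × Unique σ

seqs : ℕ → ℕ → List (List ℕ)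
seqs n zero    = [] ∷ []
seqs n (suc k) = concatMap (λ x → map (x ∷_) (seqs n k)) (map suc (upTo n))

perms : ℕ → List (List ℕ)
perms n = filter unique? (seqs n n)

des : List ℕ → ℕ
des []            = 0
des (x ∷ [])      = 0
des (x ∷ y ∷ r)   = (if does (y <? x) then 1 else 0) + des (y ∷ r)

countLess : ℕ → List ℕ → ℕ
countLess x []      = 0
countLess x (y ∷ r) = (if does (y <? x) then 1 else 0) + countLess x r

inv : List ℕ → ℕ
inv []      = 0
inv (x ∷ r) = countLess x r + inv r

-- red(w): replace the i-th smallest entry by i (for distinct entries,
-- the entry x becomes 1 + #{entries of w smaller than x})
red : List ℕ → List ℕ
red w = map (λ x → suc (countLess x w)) w

numMatches : List ℕ → List ℕ → ℕ
numMatches τ σ = length (filter (λ i → ≡-dec _≟_ (red (take (length τ) (drop i σ))) τ) (upTo (length σ)))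

MinimalOverlapping : ℕ → List ℕ → Set
MinimalOverlapping p τ =
  (Σ (List ℕ) λ σ → IsPerm (p + p ∸ 1) σ × numMatches τ σ ≡ 2)
  × (∀ i σ → i < p + p ∸ 1 → IsPerm i σ → numMatches τ σ ≡ 2 → Data.Empty.⊥)
  where import Data.Empty

-- univariate series in q: coefficient of q^i
QSer : Set
QSer = ℕ → ℤ

-- bivariate series in q, z: coefficient of q^i z^j
Ser : Set
Ser = ℕ → ℕ → ℤ

sumTo : ℕ → (ℕ → ℤ) → ℤ
sumTo zero    f = f 0
sumTo (suc n) f = sumTo n f ℤ.+ f (suc n)

_*Q_ : QSer → QSer → QSer
(f *Q g) i = sumTo i (λ a → f a ℤ.* g (i ∸ a))

oneQ : QSer
oneQ zero    = + 1
oneQ (suc _) = + 0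

qint : ℕ → QSer
qint n i = if does (i <? n) then + 1 else + 0

qfact : ℕ → QSer
qfact zero    = oneQ
qfact (suc n) = qfact n *Q qint (suc n)

-- multiplicative inverse 1/f in ℤ[[q]] of a series f with constant term 1:
-- g_0 = 1, g_n = - Σ_{i=1}^{n} f_i g_{n-i}.
-- invList f n = [g_n, g_{n-1}, …, g_0]
invStep : QSer → ℕ → List ℤ → ℤ
invStep f j []      = + 0
invStep f j (b ∷ l) = f j ℤ.* b ℤ.+ invStep f (suc j) l

invList : QSer → ℕ → List ℤ
invList f zero    = + 1 ∷ []
invList f (suc n) = (- invStep f 1 (invList f n)) ∷ invList f n

invQ : QSer → QSer
invQ f n with invList f n
... | []    = + 0
... | g ∷ _ = g

qbinom : ℕ → ℕ → QSer
qbinom m k = if does (k ≤? m)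
             then qfact m *Q invQ (qfact k *Q qfact (m ∸ k))
             else (λ _ → + 0)

_+S_ : Ser → Ser → Ser
(f +S g) i j = f i j ℤ.+ g i j

_-S_ : Ser → Ser → Ser
(f -S g) i j = f i j ℤ.- g i j

_*S_ : Ser → Ser → Ser
(f *S g) i j = sumTo i (λ a → sumTo j (λ b → f a b ℤ.* g (i ∸ a) (j ∸ b)))

zeroS : Ser
zeroS _ _ = + 0

mono : ℕ → ℕ → Ser
mono a b i j = if does (i ≟ a) ∧ does (j ≟ b) then + 1 else + 0
  where open Data.Bool using (_∧_)

oneS : Ser
oneS = mono 0 0

zS : Ser
zS = mono 0 1

embQ : QSer → Ser
embQ f i zero    = f i
embQ f i (suc _) = + 0

_≈S_ : Ser → Ser → Set
f ≈S g = ∀ i j → f i j ≡ g i j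

infixl 6 _+S_ _-S_
infixl 7 _*S_
infix 4 _≈S_

INM : List ℕ → ℕ → Ser
INM τ n = foldr (λ σ acc → mono (inv σ) (suc (des σ)) +S acc) zeroS
                (filter (λ σ → numMatches τ σ ≟ 0) (perms n))

-- coefficient sequence of INM_τ(t,q,z) w.r.t. t^n/[n]_q! (constant term 1)
INMcoeff : List ℕ → ℕ → Ser
INMcoeff τ zero    = oneS
INMcoeff τ (suc n) = INM τ (suc n)

-- U is the coefficient sequence (w.r.t. t^n/[n]_q!) of 1/INM_τ(t,q,z):
-- U_0 = 1 and, for n ≥ 1, the coefficient of t^n/[n]_q! of INM_τ · U vanishes,
-- i.e. Σ_{k=0}^{n} [n choose k]_q INM_{τ,k} U_{n-k} = 0.
sumS : ℕ → (ℕ → Ser) → Ser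
sumS zero    f = f 0
sumS (suc n) f = sumS n f +S f (suc n)

IsReciprocal : List ℕ → (ℕ → Ser) → Set
IsReciprocal τ U =
  (U 0 ≈S oneS)
  × (∀ n → 1 ≤ n → sumS n (λ k → embQ (qbinom n k) *S INMcoeff τ k *S U (n ∸ k)) ≈S zeroS)

{-# OPTIONS --safe #-}
module Submission where

-- A descent carries weight z and an ascent 1 = z + (1 - z). Expanding every link in this way, and the
-- avoidance of matches by inclusion-exclusion, turns -IU_n into z times a signed sum over chains of ascents and
-- matches. Minimal overlapping makes consecutive matches share at most one position, and τ_1 = 1 then makes
-- every step start at the minimum of what remains, which is why the chains obey the stated recurrence.
--
-- To verify it, let A_{n,r} weigh each avoiding π in S_n by [n + r - π_n choose r]: the ways to continue π by r
-- values above π_n, so that INM_n = z A_{n,0} and A_{1,r} = 1. For n ≥ 1, appending a last value, and removing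
-- the permutations in which it completes a match, gives (N_n being A_{n,0})
--   A_{n+1,r} = z [n+r+1 choose r+1] N_n + (1-z) A_{n,r+1} - z^des(τ) q^inv(τ) [r+p-s choose r] A_{n+2-p,r+p-1}.
-- Multiplied by IU_{r+1} and summed over n + r constant, this telescopes against the definition of IU as a
-- reciprocal, and the recurrence for IU follows by strong induction.

-- The weight in A_{n,r} records the last value, because both kinds of step must go above it: an
-- ascent, and the rest of a match, as τ_1 = 1. The r extra values stand for a continuation still to
-- be arranged. A step placing values above π_n only has to interleave them with these, so the
-- family A is closed under both steps. After a match, p - s of its values lie above its last one;
-- interleaving them with r others gives [r+p-s choose r], which is how s enters.
--
-- Removing a completed match meets an obstacle: all values but the last must avoid τ, while
-- splitting at the match controls only those up to its first value. Minimal overlapping closes the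
-- gap, as a match not confined to those would share at least two positions with the final one.
--
-- The argument runs over any commutative ring with inverses of the q-factorials and some y with z +
-- y = 1; as a series in q, [n]_q! has constant term 1 and is invertible. Permutations are
-- zero-based there: κ₀ is τ_2 ... τ_p lowered by 2, so p = k + 2 and s = c + 2.

open import Defs
open import Level using (0ℓ)
open import Algebra.Bundles using (CommutativeRing)
open import Data.Bool using (Bool; true; false; if_then_else_; _∧_; T)
open import Data.Empty using (⊥; ⊥-elim)
open import Data.Integer as ℤ using (ℤ; +_)
import Data.Integer.Properties as ℤₚ
open import Data.List using (List; []; _∷_; [_]; _++_; map; upTo; length; take; drop; filter; foldr; concatMap; head; last)
import Data.List.Properties as Listₚ
open import Data.List.Membership.Propositional using (_∈_; _∉_)
open import Data.List.Membership.Propositional.Properties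
  using (∈-filter⁺; ∈-upTo⁺; ∈-upTo⁻; ∈-map⁺; ∈-map⁻; ∈-∃++)
open import Data.List.Relation.Unary.All as All using (All; []; _∷_; all?)
open import Data.List.Relation.Unary.AllPairs as AllPairs using ([]; _∷_)
open import Data.List.Relation.Unary.Any using (here; there)
open import Data.List.Relation.Binary.Permutation.Propositional as Perm
  using (_↭_; prep; swap; ↭-refl; ↭-sym; ↭-trans)
import Data.List.Relation.Binary.Permutation.Propositional.Properties as Permₚ
import Data.List.Relation.Binary.Permutation.Setoid.Properties as Permₛ
open import Data.Maybe using (just)
import Data.Maybe.Properties as Maybeₚ
open import Data.Nat as ℕ using (ℕ; zero; suc; _∸_; _≤_; _<_; _<ᵇ_; z≤n; s≤s; _≟_; _<?_; _≤?_)
open import Data.Nat.Induction using (<-rec)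
open import Data.Nat.ListAction using (sum)
open import Data.Nat.ListAction.Properties using (sum-↭)
import Data.Nat.Properties as ℕₚ
open import Data.Nat.Tactic.RingSolver using (solve-∀)
open import Data.List.Relation.Unary.Unique.DecPropositional _≟_ using (Unique; unique?)
import Data.List.Relation.Unary.Unique.Propositional.Properties as Uniqueₚ
open import Data.Product using (_×_; _,_; proj₁; proj₂; Σ-syntax)
open import Data.Sum using (_⊎_; inj₁; inj₂)
open import Data.Unit using (tt)
open import Function using (_∘_; mk⇔)
open import Relation.Binary using (tri<; tri≈; tri>)
open import Relation.Binary.PropositionalEquality as ≡ using (_≡_; _≢_)
open import Relation.Nullary using (Dec; yes; no; does; ¬_; ¬?; contradiction)
open import Relation.Nullary.Decidable using (dec-true; dec-false; does-⇔; _×-dec_)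
open import Relation.Unary using (Decidable)
import Algebra.Solver.Ring.NaturalCoefficients.Default as NatSolver
import Algebra.Properties.Semiring.Exp as Exp

-- Power series over a commutative ring

module DiagonalSums (R : CommutativeRing 0ℓ 0ℓ) where
  open CommutativeRing R hiding (zero)
  open NatSolver commutativeSemiring using (solve; _:=_; _:+_; _:*_)
  open import Relation.Binary.Reasoning.Setoid setoid

  -- Cauchy products are indexed by pairs with i + j = n instead of i and `n ∸ i`, so that
  -- reindexing involves no truncated subtraction.
  diag : ℕ → (ℕ → ℕ → Carrier) → Carrier
  diag zero    h = h 0 0
  diag (suc n) h = h 0 (suc n) + diag n (λ i j → h (suc i) j)

  diag-cong : ∀ n {f g : ℕ → ℕ → Carrier} →
              (∀ i j → i ℕ.+ j ≡ n → f i j ≈ g i j) → diag n f ≈ diag n g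
  diag-cong zero    e = e 0 0 ≡.refl
  diag-cong (suc n) e = +-cong (e 0 (suc n) ≡.refl)
                               (diag-cong n (λ i j p → e (suc i) j (≡.cong suc p)))

  diag-cong′ : ∀ n {f g : ℕ → ℕ → Carrier} → (∀ i j → f i j ≈ g i j) → diag n f ≈ diag n g
  diag-cong′ n e = diag-cong n (λ i j _ → e i j)

  diag-+ : ∀ n (f g : ℕ → ℕ → Carrier) →
           diag n (λ i j → f i j + g i j) ≈ diag n f + diag n g
  diag-+ zero    f g = refl
  diag-+ (suc n) f g = trans (+-congˡ (diag-+ n _ _))
    (solve 4 (λ a b c d → (a :+ b) :+ (c :+ d) := (a :+ c) :+ (b :+ d)) refl _ _ _ _)

  diag-*ˡ : ∀ n c (f : ℕ → ℕ → Carrier) → diag n (λ i j → c * f i j) ≈ c * diag n f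
  diag-*ˡ zero    c f = refl
  diag-*ˡ (suc n) c f = trans (+-congˡ (diag-*ˡ n c _)) (sym (distribˡ _ _ _))

  diag-*ʳ : ∀ n c (f : ℕ → ℕ → Carrier) → diag n (λ i j → f i j * c) ≈ diag n f * c
  diag-*ʳ n c f = trans (diag-cong′ n (λ i j → *-comm _ _)) (trans (diag-*ˡ n c f) (*-comm _ _))

  diag-0 : ∀ n {f : ℕ → ℕ → Carrier} → (∀ i j → i ℕ.+ j ≡ n → f i j ≈ 0#) → diag n f ≈ 0#
  diag-0 zero    e = e 0 0 ≡.refl
  diag-0 (suc n) e = trans (+-cong (e 0 (suc n) ≡.refl)
    (diag-0 n (λ i j p → e (suc i) j (≡.cong suc p)))) (+-identityˡ _)

  diag-last : ∀ n (h : ℕ → ℕ → Carrier) →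
              diag (suc n) h ≈ diag n (λ i j → h i (suc j)) + h (suc n) 0
  diag-last zero    h = refl
  diag-last (suc n) h = trans (+-congˡ (diag-last n (λ i j → h (suc i) j))) (sym (+-assoc _ _ _))

  diag-flip : ∀ n (h : ℕ → ℕ → Carrier) → diag n h ≈ diag n (λ i j → h j i)
  diag-flip zero    h = refl
  diag-flip (suc n) h = begin
    diag (suc n) h                                 ≈⟨ diag-last n h ⟩
    diag n (λ i j → h i (suc j)) + h (suc n) 0     ≈⟨ +-comm _ _ ⟩
    h (suc n) 0 + diag n (λ i j → h i (suc j))     ≈⟨ +-congˡ (diag-flip n _) ⟩
    h (suc n) 0 + diag n (λ i j → h j (suc i))     ∎

  -- Two ways to sum over i + j + k = n; for a product of three coefficients this is associativity
  -- of the Cauchy product.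
  diag-assoc : ∀ n (F : ℕ → ℕ → ℕ → Carrier) →
    diag n (λ m k → diag m (λ i j → F i j k)) ≈ diag n (λ i m → diag m (λ j k → F i j k))
  diag-assoc zero    F = refl
  diag-assoc (suc n) F = begin
    F 0 0 (suc n) + diag n (λ m k → F 0 (suc m) k + diag m (λ i j → F (suc i) j k))
      ≈⟨ +-congˡ (diag-+ n _ _) ⟩
    F 0 0 (suc n) + (diag n (λ m k → F 0 (suc m) k) + diag n (λ m k → diag m (λ i j → F (suc i) j k)))
      ≈⟨ sym (+-assoc _ _ _) ⟩
    diag (suc n) (F 0) + diag n (λ m k → diag m (λ i j → F (suc i) j k))
      ≈⟨ +-congˡ (diag-assoc n (λ i → F (suc i))) ⟩
    diag (suc n) (F 0) + diag n (λ i m → diag m (λ j k → F (suc i) j k)) ∎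

  partial : ℕ → (ℕ → Carrier) → Carrier
  partial zero    f = f 0
  partial (suc n) f = partial n f + f (suc n)

  partial-cong : ∀ n {f g : ℕ → Carrier} → (∀ i → i ≤ n → f i ≈ g i) → partial n f ≈ partial n g
  partial-cong zero    e = e 0 z≤n
  partial-cong (suc n) e = +-cong (partial-cong n (λ i l → e i (ℕₚ.m≤n⇒m≤1+n l))) (e (suc n) ℕₚ.≤-refl)

  -- Connects the sums of the definitions, which use truncated subtraction, with diagonal sums.
  partial-diag : ∀ n (h : ℕ → ℕ → Carrier) → partial n (λ i → h i (n ℕ.∸ i)) ≈ diag n h
  partial-diag zero    h = refl
  partial-diag (suc n) h = trans
    (+-cong (trans (partial-cong n (λ i l → reflexive (≡.cong (h i) (ℕₚ.+-∸-assoc 1 l))))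
                   (partial-diag n (λ i j → h i (suc j))))
            (reflexive (≡.cong (h (suc n)) (ℕₚ.n∸n≡0 (suc n)))))
    (sym (diag-last n h))

module PowerSeries (R : CommutativeRing 0ℓ 0ℓ) where
  open CommutativeRing R hiding (zero)
  open DiagonalSums R

  private
    _⊗_ : (ℕ → Carrier) → (ℕ → Carrier) → ℕ → Carrier
    (f ⊗ g) n = diag n (λ i j → f i * g j)

    𝟙 : ℕ → Carrier
    𝟙 zero    = 1#
    𝟙 (suc _) = 0#

    ⊗-identityˡ : ∀ f n → (𝟙 ⊗ f) n ≈ f n
    ⊗-identityˡ f zero    = *-identityˡ _
    ⊗-identityˡ f (suc n) = trans (+-cong (*-identityˡ _) (diag-0 n (λ _ _ _ → zeroˡ _))) (+-identityʳ _)

    ⊗-comm : ∀ f g n → (f ⊗ g) n ≈ (g ⊗ f) n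
    ⊗-comm f g n = trans (diag-flip n _) (diag-cong′ n (λ _ _ → *-comm _ _))

    ⊗-assoc : ∀ f g h n → ((f ⊗ g) ⊗ h) n ≈ (f ⊗ (g ⊗ h)) n
    ⊗-assoc f g h n = begin
      diag n (λ m k → diag m (λ i j → f i * g j) * h k)
        ≈⟨ diag-cong′ n (λ m k → sym (diag-*ʳ m (h k) _)) ⟩
      diag n (λ m k → diag m (λ i j → f i * g j * h k))
        ≈⟨ diag-assoc n (λ i j k → f i * g j * h k) ⟩
      diag n (λ i m → diag m (λ j k → f i * g j * h k))
        ≈⟨ diag-cong′ n (λ i m → trans (diag-cong′ m (λ _ _ → *-assoc _ _ _)) (diag-*ˡ m (f i) _)) ⟩
      diag n (λ i m → f i * diag m (λ j k → g j * h k)) ∎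
      where open import Relation.Binary.Reasoning.Setoid setoid

    ⊗-distribʳ : ∀ f g h n → ((λ i → g i + h i) ⊗ f) n ≈ (g ⊗ f) n + (h ⊗ f) n
    ⊗-distribʳ f g h n = trans (diag-cong′ n (λ _ _ → distribʳ _ _ _)) (diag-+ n _ _)

  powerSeries : CommutativeRing 0ℓ 0ℓ
  powerSeries = record
    { Carrier = ℕ → Carrier
    ; _≈_ = λ f g → ∀ n → f n ≈ g n
    ; _+_ = λ f g n → f n + g n
    ; _*_ = _⊗_
    ; -_  = λ f n → - f n
    ; 0#  = λ _ → 0#
    ; 1#  = 𝟙
    ; isCommutativeRing = record
      { isRing = record
        { +-isAbelianGroup = record
          { isGroup = record
            { isMonoid = record
              { isSemigroup = record
                { isMagma = record
                  { isEquivalence = record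
                    { refl = λ _ → refl ; sym = λ e n → sym (e n) ; trans = λ d e n → trans (d n) (e n) }
                  ; ∙-cong = λ d e n → +-cong (d n) (e n)
                  }
                ; assoc = λ f g h n → +-assoc _ _ _
                }
              ; identity = (λ f n → +-identityˡ _) , (λ f n → +-identityʳ _)
              }
            ; inverse = (λ f n → -‿inverseˡ _) , (λ f n → -‿inverseʳ _)
            ; ⁻¹-cong = λ e n → -‿cong (e n)
            }
          ; comm = λ f g n → +-comm _ _
          }
        ; *-cong = λ d e n → diag-cong′ n (λ i j → *-cong (d i) (e j))
        ; *-assoc = ⊗-assoc
        ; *-identity = ⊗-identityˡ , (λ f n → trans (⊗-comm f 𝟙 n) (⊗-identityˡ f n))
        ; distrib = (λ f g h n → trans (⊗-comm f _ n)
                        (trans (⊗-distribʳ f g h n) (+-cong (⊗-comm g f n) (⊗-comm h f n))))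
                  , ⊗-distribʳ
        }
      ; *-comm = ⊗-comm
      }
    }

  X : ℕ → Carrier
  X 1 = 1#
  X _ = 0#

  constant : Carrier → ℕ → Carrier
  constant c zero    = c
  constant c (suc _) = 0#

  X⊗-zero : ∀ f → (X ⊗ f) 0 ≈ 0#
  X⊗-zero f = zeroˡ _

  X⊗-suc : ∀ f n → (X ⊗ f) (suc n) ≈ f n
  X⊗-suc f n = trans (+-cong (zeroˡ _) (trans (diag-cong′ n (λ { zero j → refl ; (suc i) j → refl }))
    (⊗-identityˡ f n))) (+-identityˡ _)

  constant⊗ : ∀ c f n → (constant c ⊗ f) n ≈ c * f n
  constant⊗ c f zero    = refl
  constant⊗ c f (suc n) = trans (+-congˡ (diag-0 n (λ _ _ _ → zeroˡ _))) (+-identityʳ _)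

-- Sums over arrangements and shuffles

Unique-resp-↭ : ∀ {xs ys : List ℕ} → xs ↭ ys → Unique xs → Unique ys
Unique-resp-↭ p = Permₛ.Unique-resp-↭ (≡.setoid ℕ) (Perm.↭⇒↭ₛ p)

upTo-suc : ∀ n → upTo (suc n) ≡ 0 ∷ map suc (upTo n)
upTo-suc n = ≡.cong (0 ∷_) (≡.sym (Listₚ.map-upTo suc n))

-- A word marks each value as going left (false) or right (true);
-- posL w y and posR w y are the y-th values going left and right.
posL posR : List Bool → ℕ → ℕ
posL []          y       = y
posL (false ∷ w) zero    = zero
posL (false ∷ w) (suc y) = suc (posL w y)
posL (true ∷ w)  y       = suc (posL w y)
posR []          y       = y
posR (true ∷ w)  zero    = zero
posR (true ∷ w)  (suc y) = suc (posR w y)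
posR (false ∷ w) y       = suc (posR w y)

lefts : List Bool → ℕ
lefts []          = 0
lefts (false ∷ w) = suc (lefts w)
lefts (true ∷ w)  = lefts w

rights : List Bool → ℕ
rights []          = 0
rights (false ∷ w) = rights w
rights (true ∷ w)  = suc (rights w)

-- Inversions between the two blocks of a shuffle: the left block is written first, so a value going
-- right is inverted with every larger value going left.
winv : List Bool → ℕ
winv []          = 0
winv (false ∷ w) = winv w
winv (true ∷ w)  = lefts w ℕ.+ winv w

map-posL-false : ∀ w i → map (posL (false ∷ w)) (upTo (suc i)) ≡ 0 ∷ map suc (map (posL w) (upTo i))
map-posL-false w i = ≡.trans (≡.cong (map _) (upTo-suc i))
  (≡.cong (0 ∷_) (≡.trans (≡.sym (Listₚ.map-∘ (upTo i))) (Listₚ.map-∘ (upTo i))))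

map-posR-true : ∀ w i → map (posR (true ∷ w)) (upTo (suc i)) ≡ 0 ∷ map suc (map (posR w) (upTo i))
map-posR-true w i = ≡.trans (≡.cong (map _) (upTo-suc i))
  (≡.cong (0 ∷_) (≡.trans (≡.sym (Listₚ.map-∘ (upTo i))) (Listₚ.map-∘ (upTo i))))

map-posL-true : ∀ w L → map (posL (true ∷ w)) L ≡ map suc (map (posL w) L)
map-posL-true w L = Listₚ.map-∘ L

map-posR-false : ∀ w L → map (posR (false ∷ w)) L ≡ map suc (map (posR w) L)
map-posR-false w L = Listₚ.map-∘ L

-- An arbitrary alphabet replaces 1, ..., n, since the induction over duplicate-free sequences
-- deletes letters already used.
seqsFrom : List ℕ → ℕ → List (List ℕ)
seqsFrom L zero    = [] ∷ []
seqsFrom L (suc k) = concatMap (λ x → map (x ∷_) (seqsFrom L k)) L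

seqs≡seqsFrom : ∀ n k → seqs n k ≡ seqsFrom (map suc (upTo n)) k
seqs≡seqsFrom n zero    = ≡.refl
seqs≡seqsFrom n (suc k) rewrite seqs≡seqsFrom n k = ≡.refl

module ArrangementSums (R : CommutativeRing 0ℓ 0ℓ) where
  open CommutativeRing R hiding (zero)
  open NatSolver commutativeSemiring using (solve; _:=_; _:+_; _:*_)

  private
    interchange : ∀ a b c d → (a + b) + (c + d) ≈ (a + c) + (b + d)
    interchange = solve 4 (λ a b c d → (a :+ b) :+ (c :+ d) := (a :+ c) :+ (b :+ d)) refl

  -- Sums take the summand as a continuation instead of running over a list of arrangements;
  -- exchanging summations then becomes an induction on the same recursion.
  pick : List ℕ → (ℕ → List ℕ → Carrier) → Carrier
  pick []      g = 0#
  pick (x ∷ L) g = g x L + pick L (λ y L′ → g y (x ∷ L′))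

  arr : ℕ → List ℕ → (List ℕ → Carrier) → Carrier
  arr zero    L f = f []
  arr (suc k) L f = pick L (λ x L′ → arr k L′ (λ σ → f (x ∷ σ)))

  private
    arrRest : ℕ → List ℕ → (List ℕ → List ℕ → Carrier) → Carrier
    arrRest zero    L g = g [] L
    arrRest (suc i) L g = pick L (λ x L′ → arrRest i L′ (λ α L″ → g (x ∷ α) L″))

  split : ℕ → List ℕ → (List ℕ → List ℕ → Carrier) → Carrier
  split zero    []      g = g [] []
  split (suc i) []      g = 0#
  split zero    (x ∷ L) g = split zero L (λ A B → g A (x ∷ B))
  split (suc i) (x ∷ L) g = split i L (λ A B → g (x ∷ A) B) + split (suc i) L (λ A B → g A (x ∷ B))

  bits : ℕ → ℕ → (List Bool → Carrier) → Carrier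
  bits zero    zero    g = g []
  bits (suc i) zero    g = bits i zero (g ∘ (false ∷_))
  bits zero    (suc k) g = bits zero k (g ∘ (true ∷_))
  bits (suc i) (suc k) g = bits i (suc k) (g ∘ (false ∷_)) + bits (suc i) k (g ∘ (true ∷_))

  perm : ℕ → (List ℕ → Carrier) → Carrier
  perm n = arr n (upTo n)

  listΣ : ∀ {A : Set} → List A → (A → Carrier) → Carrier
  listΣ []       f = 0#
  listΣ (x ∷ xs) f = f x + listΣ xs f

  only : Bool → Carrier → Carrier
  only b x = if b then x else 0#

  only-cong : ∀ b {x y} → x ≈ y → only b x ≈ only b y
  only-cong true  e = e
  only-cong false e = refl

  only-true : ∀ {b} {x} → b ≡ true → only b x ≈ x
  only-true ≡.refl = refl

  only-false : ∀ {b} {x} → b ≡ false → only b x ≈ 0#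
  only-false ≡.refl = refl

  pick-cong : ∀ L {f g} → (∀ y L′ → L ↭ y ∷ L′ → f y L′ ≈ g y L′) → pick L f ≈ pick L g
  pick-cong []      e = refl
  pick-cong (x ∷ L) e = +-cong (e x L ↭-refl)
    (pick-cong L (λ y L′ p → e y (x ∷ L′) (↭-trans (prep x p) (swap x y ↭-refl))))

  pick-+ : ∀ L f g → pick L (λ y L′ → f y L′ + g y L′) ≈ pick L f + pick L g
  pick-+ []      f g = sym (+-identityˡ _)
  pick-+ (x ∷ L) f g = trans (+-congˡ (pick-+ L _ _)) (interchange _ _ _ _)

  pick-*ˡ : ∀ L c f → pick L (λ y L′ → c * f y L′) ≈ c * pick L f
  pick-*ˡ []      c f = sym (zeroʳ _)
  pick-*ˡ (x ∷ L) c f = trans (+-congˡ (pick-*ˡ L c _)) (sym (distribˡ _ _ _))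

  pick-map : ∀ (φ : ℕ → ℕ) L g → pick (map φ L) g ≈ pick L (λ y L′ → g (φ y) (map φ L′))
  pick-map φ []      g = refl
  pick-map φ (x ∷ L) g = +-congˡ (pick-map φ L _)

  pick-listΣ : ∀ L f → pick L (λ y _ → f y) ≈ listΣ L f
  pick-listΣ []      f = refl
  pick-listΣ (x ∷ L) f = +-congˡ (pick-listΣ L f)

  arr-cong′ : ∀ k L {f g} → (∀ σ → f σ ≈ g σ) → arr k L f ≈ arr k L g
  arr-cong′ zero    L e = e []
  arr-cong′ (suc k) L e = pick-cong L (λ x L′ _ → arr-cong′ k L′ (λ σ → e (x ∷ σ)))

  -- When L is used up completely, the sequences summed over are rearrangements of L, and the
  -- summands need to agree only there.
  arr-cong : ∀ k L {f g} → length L ≡ k → (∀ σ → σ ↭ L → f σ ≈ g σ) → arr k L f ≈ arr k L g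
  arr-cong zero    []      l e = e [] ↭-refl
  arr-cong (suc k) L       l e = pick-cong L (λ x L′ p → arr-cong k L′
    (ℕₚ.suc-injective (≡.trans (≡.sym (Permₚ.↭-length p)) l))
    (λ σ s → e (x ∷ σ) (↭-trans (prep x s) (↭-sym p))))

  arr-+ : ∀ k L f g → arr k L (λ σ → f σ + g σ) ≈ arr k L f + arr k L g
  arr-+ zero    L f g = refl
  arr-+ (suc k) L f g = trans (pick-cong L (λ x L′ _ → arr-+ k L′ _ _)) (pick-+ L _ _)

  arr-*ˡ : ∀ k L c f → arr k L (λ σ → c * f σ) ≈ c * arr k L f
  arr-*ˡ zero    L c f = refl
  arr-*ˡ (suc k) L c f = trans (pick-cong L (λ x L′ _ → arr-*ˡ k L′ c _)) (pick-*ˡ L c _)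

  arr-map : ∀ k (φ : ℕ → ℕ) L f → arr k (map φ L) f ≈ arr k L (λ σ → f (map φ σ))
  arr-map zero    φ L f = refl
  arr-map (suc k) φ L f = trans (pick-map φ L _) (pick-cong L (λ x L′ _ → arr-map k φ L′ _))

  perm-cong : ∀ n {f g} → (∀ σ → σ ↭ upTo n → f σ ≈ g σ) → perm n f ≈ perm n g
  perm-cong n = arr-cong n (upTo n) (Listₚ.length-upTo n)

  split-+ : ∀ i L f g → split i L (λ A B → f A B + g A B) ≈ split i L f + split i L g
  split-+ zero    []      f g = refl
  split-+ (suc i) []      f g = sym (+-identityˡ _)
  split-+ zero    (x ∷ L) f g = split-+ zero L _ _
  split-+ (suc i) (x ∷ L) f g = trans (+-cong (split-+ i L _ _) (split-+ (suc i) L _ _)) (interchange _ _ _ _)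

  split-map : ∀ (φ : ℕ → ℕ) i L g → split i (map φ L) g ≈ split i L (λ A B → g (map φ A) (map φ B))
  split-map φ zero    []      g = refl
  split-map φ (suc i) []      g = refl
  split-map φ zero    (x ∷ L) g = split-map φ zero L _
  split-map φ (suc i) (x ∷ L) g = +-cong (split-map φ i L _) (split-map φ (suc i) L _)

  split-short : ∀ i L g → length L < i → split i L g ≈ 0#
  split-short (suc i) []      g l       = refl
  split-short (suc i) (x ∷ L) g (s≤s l) = trans
    (+-cong (split-short i L _ l) (split-short (suc i) L _ (ℕₚ.m≤n⇒m≤1+n l))) (+-identityˡ _)

  bits-cong : ∀ i k {f g} → (∀ w → lefts w ≡ i → rights w ≡ k → f w ≈ g w) → bits i k f ≈ bits i k g
  bits-cong zero    zero    e = e [] ≡.refl ≡.refl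
  bits-cong (suc i) zero    e = bits-cong i zero (λ w p q → e (false ∷ w) (≡.cong suc p) q)
  bits-cong zero    (suc k) e = bits-cong zero k (λ w p q → e (true ∷ w) p (≡.cong suc q))
  bits-cong (suc i) (suc k) e = +-cong (bits-cong i (suc k) (λ w p q → e (false ∷ w) (≡.cong suc p) q))
                                       (bits-cong (suc i) k (λ w p q → e (true ∷ w) p (≡.cong suc q)))

  bits-*ˡ : ∀ i k c f → bits i k (λ w → c * f w) ≈ c * bits i k f
  bits-*ˡ zero    zero    c f = refl
  bits-*ˡ (suc i) zero    c f = bits-*ˡ i zero c _
  bits-*ˡ zero    (suc k) c f = bits-*ˡ zero k c _
  bits-*ˡ (suc i) (suc k) c f = trans (+-cong (bits-*ˡ i (suc k) c _) (bits-*ˡ (suc i) k c _))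
                                      (sym (distribˡ _ _ _))

  bits-0 : ∀ i k → bits i k (λ _ → 0#) ≈ 0#
  bits-0 i k = trans (bits-cong i k (λ _ _ _ → sym (zeroˡ 0#))) (trans (bits-*ˡ i k 0# _) (zeroˡ _))

  bits-arr : ∀ i k n L (h : List Bool → List ℕ → Carrier) →
             bits i k (λ w → arr n L (h w)) ≈ arr n L (λ σ → bits i k (λ w → h w σ))
  bits-arr zero    zero    n L h = refl
  bits-arr (suc i) zero    n L h = bits-arr i zero n L _
  bits-arr zero    (suc k) n L h = bits-arr zero k n L _
  bits-arr (suc i) (suc k) n L h = trans (+-cong (bits-arr i (suc k) n L _) (bits-arr (suc i) k n L _))
                                         (sym (arr-+ n L _ _))

  private
    arr-++ : ∀ i k L f → arr (i ℕ.+ k) L f ≈ arrRest i L (λ α L′ → arr k L′ (λ β → f (α ++ β)))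
    arr-++ zero    k L f = refl
    arr-++ (suc i) k L f = pick-cong L (λ x L′ _ → arr-++ i k L′ _)

    split-zero-pick : ∀ L (h : ℕ → List ℕ → List ℕ → Carrier) →
                      split zero L (λ A B → pick A (λ x A′ → h x A′ B)) ≈ 0#
    split-zero-pick []      h = refl
    split-zero-pick (y ∷ L) h = split-zero-pick L (λ x A B → h x A (y ∷ B))

    -- One chosen entry together with i others is the same as i + 1 entries with one of them singled
    -- out.
    pick-split : ∀ i L (h : ℕ → List ℕ → List ℕ → Carrier) →
      pick L (λ x L′ → split i L′ (h x)) ≈ split (suc i) L (λ A B → pick A (λ x A′ → h x A′ B))
    pick-split i       []      h = refl
    pick-split zero    (y ∷ L) h = +-cong
      (sym (trans (split-+ zero L _ _) (trans (+-congˡ (split-zero-pick L (λ x A′ B → h x (y ∷ A′) B))) (+-identityʳ _))))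
      (pick-split zero L (λ x A B → h x A (y ∷ B)))
    pick-split (suc i) (y ∷ L) h =
      trans (+-congˡ (trans (pick-+ L _ _)
               (+-cong (pick-split i L (λ x A B → h x (y ∷ A) B))
                       (pick-split (suc i) L (λ x A B → h x A (y ∷ B))))))
      (trans (sym (+-assoc _ _ _)) (+-congʳ (sym (split-+ (suc i) L _ _))))

    arrRest-split : ∀ i L g → arrRest i L g ≈ split i L (λ A B → arr i A (λ α → g α B))
    arrRest-split zero    []      g = refl
    arrRest-split zero    (x ∷ L) g = arrRest-split zero L (λ α L′ → g α (x ∷ L′))
    arrRest-split (suc i) L       g = trans (pick-cong L (λ x L′ _ → arrRest-split i L′ _))
                                            (pick-split i L (λ x A B → arr i A (λ α → g (x ∷ α) B)))

    -- Letter v of the word decides the side of the value v, so the recursion peels off the smallest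
    -- value.
    split-upTo : ∀ i k g → split i (upTo (i ℕ.+ k)) g ≈
                 bits i k (λ w → g (map (posL w) (upTo i)) (map (posR w) (upTo k)))
    split-upTo-left : ∀ i k g → split i (map suc (upTo (i ℕ.+ k))) (λ A B → g (0 ∷ A) B) ≈
                 bits i k (λ w → g (map (posL (false ∷ w)) (upTo (suc i))) (map (posR (false ∷ w)) (upTo k)))
    split-upTo-right : ∀ i k g → split i (map suc (upTo (i ℕ.+ k))) (λ A B → g A (0 ∷ B)) ≈
                 bits i k (λ w → g (map (posL (true ∷ w)) (upTo i)) (map (posR (true ∷ w)) (upTo (suc k))))

    split-upTo-left i k g = trans (split-map suc i (upTo (i ℕ.+ k)) _) (trans (split-upTo i k _)
      (bits-cong i k (λ w _ _ → reflexive (≡.sym (≡.cong₂ g (map-posL-false w i) (map-posR-false w (upTo k)))))))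
    split-upTo-right i k g = trans (split-map suc i (upTo (i ℕ.+ k)) _) (trans (split-upTo i k _)
      (bits-cong i k (λ w _ _ → reflexive (≡.sym (≡.cong₂ g (map-posL-true w (upTo i)) (map-posR-true w k))))))

    split-upTo-cons : ∀ i n g → split i (upTo (suc n)) g ≈ split i (0 ∷ map suc (upTo n)) g
    split-upTo-cons i n g = reflexive (≡.cong (λ L → split i L g) (upTo-suc n))

    split-upTo zero    zero    g = refl
    split-upTo (suc i) zero    g = trans (split-upTo-cons (suc i) (i ℕ.+ 0) g)
      (trans (+-cong (split-upTo-left i zero g)
                     (split-short (suc i) (map suc (upTo (i ℕ.+ 0))) _ (ℕₚ.≤-reflexive (≡.cong suc
                       (≡.trans (Listₚ.length-map suc (upTo (i ℕ.+ 0)))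
                         (≡.trans (Listₚ.length-upTo (i ℕ.+ 0)) (ℕₚ.+-identityʳ i)))))))
             (+-identityʳ _))
    split-upTo zero    (suc k) g = trans (split-upTo-cons zero k g) (split-upTo-right zero k g)
    split-upTo (suc i) (suc k) g = trans (split-upTo-cons (suc i) (i ℕ.+ suc k) g)
      (+-cong (split-upTo-left i (suc k) g)
              (trans (reflexive (≡.cong (λ n → split (suc i) (map suc (upTo n)) (λ A B → g A (0 ∷ B))) (ℕₚ.+-suc i k)))
                     (split-upTo-right (suc i) k g)))

  -- A permutation is determined by the set of its first i values, coded by w, and the relative
  -- orders ρ and κ of its two blocks.
  perm-shuffle : ∀ i k f → perm (i ℕ.+ k) f ≈
    bits i k (λ w → perm i (λ ρ → perm k (λ κ → f (map (posL w) ρ ++ map (posR w) κ))))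
  perm-shuffle i k f = trans (arr-++ i k (upTo (i ℕ.+ k)) f) (trans (arrRest-split i (upTo (i ℕ.+ k)) _)
    (trans (split-upTo i k _)
    (bits-cong i k (λ w _ _ → trans (arr-map i (posL w) (upTo i) _)
      (arr-cong′ i (upTo i) (λ ρ → arr-map k (posR w) (upTo k) _))))))

  -- Puts the sum over words innermost. In its uses that sum becomes a Gaussian binomial depending
  -- on ρ only through the last value.
  perm-shuffle-swap : ∀ i k f (h : List Bool → List ℕ → Carrier) →
    (∀ w ρ → lefts w ≡ i → rights w ≡ k → ρ ↭ upTo i →
       perm k (λ κ → f (map (posL w) ρ ++ map (posR w) κ)) ≈ h w ρ) →
    perm (i ℕ.+ k) f ≈ perm i (λ ρ → bits i k (λ w → h w ρ))
  perm-shuffle-swap i k f h e = trans (perm-shuffle i k f) (trans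
    (bits-cong i k (λ w l r → perm-cong i (λ ρ ρ↭ → e w ρ l r ρ↭)))
    (bits-arr i k i (upTo i) h))

  -- Enumerated lists as sums over arrangements

  listΣ-cong : ∀ {A : Set} (xs : List A) {f g : A → Carrier} → (∀ x → x ∈ xs → f x ≈ g x) → listΣ xs f ≈ listΣ xs g
  listΣ-cong []       e = refl
  listΣ-cong (x ∷ xs) e = +-cong (e x (here ≡.refl)) (listΣ-cong xs (λ y m → e y (there m)))

  listΣ-↭ : ∀ {A : Set} {xs ys : List A} (f : A → Carrier) → xs ↭ ys → listΣ xs f ≈ listΣ ys f
  listΣ-↭ f Perm.refl        = refl
  listΣ-↭ f (prep x p)       = +-congˡ (listΣ-↭ f p)
  listΣ-↭ f (swap x y p)     = trans (+-congˡ (+-congˡ (listΣ-↭ f p)))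
    (solve 3 (λ a b c → a :+ (b :+ c) := b :+ (a :+ c)) refl _ _ _)
  listΣ-↭ f (Perm.trans p q) = trans (listΣ-↭ f p) (listΣ-↭ f q)

  listΣ-++ : ∀ {A : Set} (xs ys : List A) (f : A → Carrier) → listΣ (xs ++ ys) f ≈ listΣ xs f + listΣ ys f
  listΣ-++ []       ys f = sym (+-identityˡ _)
  listΣ-++ (x ∷ xs) ys f = trans (+-congˡ (listΣ-++ xs ys f)) (sym (+-assoc _ _ _))

  listΣ-map : ∀ {A B : Set} (h : A → B) (xs : List A) (f : B → Carrier) → listΣ (map h xs) f ≈ listΣ xs (f ∘ h)
  listΣ-map h []       f = refl
  listΣ-map h (x ∷ xs) f = +-congˡ (listΣ-map h xs f)

  listΣ-0 : ∀ {A : Set} (xs : List A) → listΣ xs (λ _ → 0#) ≈ 0#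
  listΣ-0 []       = refl
  listΣ-0 (x ∷ xs) = trans (+-identityˡ _) (listΣ-0 xs)

  listΣ-only : ∀ {A : Set} b (xs : List A) (f : A → Carrier) → listΣ xs (λ x → only b (f x)) ≈ only b (listΣ xs f)
  listΣ-only true  xs f = refl
  listΣ-only false xs f = listΣ-0 xs

  listΣ-filter : ∀ {A : Set} {P : A → Set} (P? : ∀ x → Dec (P x)) xs (f : A → Carrier) →
                 listΣ (filter P? xs) f ≈ listΣ xs (λ x → only (does (P? x)) (f x))
  listΣ-filter P? []       f = refl
  listΣ-filter P? (x ∷ xs) f with does (P? x)
  ... | true  = +-congˡ (listΣ-filter P? xs f)
  ... | false = trans (listΣ-filter P? xs f) (sym (+-identityˡ _))

  listΣ-seqsFrom-suc : ∀ L k f → listΣ (seqsFrom L (suc k)) f ≈ listΣ L (λ x → listΣ (seqsFrom L k) (λ σ → f (x ∷ σ)))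
  listΣ-seqsFrom-suc L k f = go L
    where
    go : ∀ M → listΣ (concatMap (λ x → map (x ∷_) (seqsFrom L k)) M) f ≈
               listΣ M (λ x → listΣ (seqsFrom L k) (λ σ → f (x ∷ σ)))
    go []      = refl
    go (x ∷ M) = trans (listΣ-++ (map (x ∷_) (seqsFrom L k)) _ f)
                       (+-cong (listΣ-map (x ∷_) (seqsFrom L k) f) (go M))

  private
    fresh : ℕ → List ℕ → Bool
    fresh x σ = does (all? (λ y → ¬? (x ≟ y)) σ)

    only-∧ : ∀ a b x → only (a ∧ b) x ≈ only a (only b x)
    only-∧ true  b x = refl
    only-∧ false b x = refl

    -- In each position the condition `fresh x` strikes out the letter x, which L contains exactly
    -- once.
    listΣ-fresh : ∀ {x L L′} k f → L ↭ x ∷ L′ → x ∉ L′ →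
      listΣ (seqsFrom L k) (λ σ → only (fresh x σ) (f σ)) ≈ listΣ (seqsFrom L′ k) f
    listΣ-fresh zero    f p x∉ = refl
    listΣ-fresh {x} {L} {L′} (suc k) f p x∉ =
      trans (listΣ-seqsFrom-suc L k _)
      (trans (listΣ-cong L (λ y _ → trans
        (listΣ-cong (seqsFrom L k) (λ σ _ → only-∧ (does (¬? (x ≟ y))) (fresh x σ) _))
        (trans (listΣ-only (does (¬? (x ≟ y))) (seqsFrom L k) _)
               (only-cong (does (¬? (x ≟ y))) (listΣ-fresh k (λ σ → f (y ∷ σ)) p x∉)))))
      (trans (listΣ-↭ _ p)
      (trans (+-cong (only-false (dec-false (¬? (x ≟ x)) (λ ne → ne ≡.refl)))
                     (listΣ-cong L′ (λ y m → reflexive (≡.cong (λ b → only b _)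
                        (dec-true (¬? (x ≟ y)) (λ { ≡.refl → x∉ m }))))))
      (trans (+-identityˡ _) (sym (listΣ-seqsFrom-suc L′ k f))))))

  -- Links the filtered enumeration behind `perms` to `arr`: after a first letter x come
  -- duplicate-free sequences over the other letters.
  arr-unique : ∀ k {L} f → Unique L →
    listΣ (seqsFrom L k) (λ σ → only (does (unique? σ)) (f σ)) ≈ arr k L f
  arr-unique zero    f u = +-identityʳ _
  arr-unique (suc k) {L} f u = sym (trans
    (pick-cong L (λ x L′ p → step x L′ p (Unique-resp-↭ p u)))
    (trans (pick-listΣ L _) (sym (listΣ-seqsFrom-suc L k _))))
    where
    step : ∀ x L′ → L ↭ x ∷ L′ → Unique (x ∷ L′) →
      arr k L′ (λ σ → f (x ∷ σ)) ≈ listΣ (seqsFrom L k) (λ σ → only (does (unique? (x ∷ σ))) (f (x ∷ σ)))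
    step x L′ p (x∉ ∷ u′) = trans (sym (arr-unique k _ u′)) (trans
      (sym (listΣ-fresh k _ p (λ m → All.lookup x∉ m ≡.refl)))
      (listΣ-cong (seqsFrom L k) (λ σ _ → sym (only-∧ (fresh x σ) (does (unique? σ)) _))))

  private
    pick-δ : ∀ {L y} → Unique L → y ∈ L → Σ[ L′ ∈ List ℕ ] (L ↭ y ∷ L′) ×
             (∀ g → pick L (λ x M → only (does (x ≟ y)) (g M)) ≈ g L′)
    pick-δ {x ∷ L} (x∉ ∷ u) (here ≡.refl) = L , ↭-refl , λ g → trans
      (+-cong (only-true (dec-true (x ≟ x) ≡.refl))
              (trans (pick-cong L (λ z M p → only-false (dec-false (z ≟ x)
                        (λ { ≡.refl → All.lookup x∉ (Permₚ.∈-resp-↭ (↭-sym p) (here ≡.refl)) ≡.refl }))))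
                     (trans (pick-listΣ L _) (listΣ-0 L))))
      (+-identityʳ _)
    pick-δ {x ∷ L} {y} (x∉ ∷ u) (there m) with pick-δ u m
    ... | L′ , p , e = x ∷ L′ , ↭-trans (prep x p) (swap x y ↭-refl) , λ g → trans
      (+-cong (only-false (dec-false (x ≟ y) (λ { ≡.refl → All.lookup x∉ m ≡.refl })))
              (e (λ M → g (x ∷ M))))
      (+-identityˡ _)

  -- Serves to extract the only relative order κ₀ that a match allows; distinct entries make it
  -- occur once.
  arr-δ : ∀ {L} κ f → Unique L → κ ↭ L →
          arr (length κ) L (λ σ → only (does (Listₚ.≡-dec _≟_ σ κ)) (f σ)) ≈ f κ
  arr-δ []      f u p = refl
  arr-δ {L} (y ∷ κ) f u p with pick-δ u (Permₚ.∈-resp-↭ p (here ≡.refl))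
  ... | L′ , q , e = trans (pick-cong L (λ x M _ → step x M)) (trans (e _) rest)
    where
    L′-unique : Unique L′
    L′-unique = AllPairs.tail (Unique-resp-↭ q u)
    step : ∀ x M → arr (length κ) M (λ σ → only (does (Listₚ.≡-dec _≟_ (x ∷ σ) (y ∷ κ))) (f (x ∷ σ))) ≈
                   only (does (x ≟ y)) (arr (length κ) M (λ σ → only (does (Listₚ.≡-dec _≟_ σ κ)) (f (y ∷ σ))))
    step x M with x ℕ.≡ᵇ y in eq
    ... | true  = arr-cong′ (length κ) M (λ σ → reflexive (≡.cong (λ x → only (does (Listₚ.≡-dec _≟_ σ κ)) (f (x ∷ σ)))
                    (ℕₚ.≡ᵇ⇒≡ x y (≡.subst T (≡.sym eq) tt))))
    ... | false = trans (arr-cong′ (length κ) M (λ σ → sym (zeroˡ 0#)))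
                        (trans (arr-*ˡ (length κ) M 0# _) (zeroˡ _))
    rest : arr (length κ) L′ (λ σ → only (does (Listₚ.≡-dec _≟_ σ κ)) (f (y ∷ σ))) ≈ f (y ∷ κ)
    rest = arr-δ κ (λ σ → f (y ∷ σ)) L′-unique (Permₚ.drop-∷ (↭-trans p q))

-- Order invariance and consecutive matches

StrictlyMonotone : (ℕ → ℕ) → Set
StrictlyMonotone φ = ∀ {x y} → x < y → φ x < φ y

-- Phrased with `<ᵇ`, the Boolean that `des` and `countLess` compute with, and only on entries of w,
-- since `rank w` need not be strictly monotone elsewhere.
PreservesOrder : (ℕ → ℕ) → List ℕ → Set
PreservesOrder φ w = ∀ {x y} → x ∈ w → y ∈ w → (φ y <ᵇ φ x) ≡ (y <ᵇ x)

reflects-monotone : ∀ (φ : ℕ → ℕ) (x y : ℕ) → (x < y → φ x < φ y) → (y < x → φ y < φ x) →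
                    (φ y <ᵇ φ x) ≡ (y <ᵇ x)
reflects-monotone φ x y up down = does-⇔ (mk⇔ back down) (φ y <? φ x) (y <? x)
  where
  back : φ y < φ x → y < x
  back l with ℕₚ.<-cmp x y
  ... | tri< a _ _    = contradiction (up a) (ℕₚ.<⇒≯ l)
  ... | tri≈ _ ≡.refl _ = contradiction l (ℕₚ.<-irrefl ≡.refl)
  ... | tri> _ _ c    = c

monotone⇒preserves : ∀ {φ} w → StrictlyMonotone φ → PreservesOrder φ w
monotone⇒preserves {φ} w m {x} {y} _ _ = reflects-monotone φ x y m m

countLess-map : ∀ φ x w → (∀ {y} → y ∈ w → (φ y <ᵇ φ x) ≡ (y <ᵇ x)) →
                countLess (φ x) (map φ w) ≡ countLess x w
countLess-map φ x []      e = ≡.refl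
countLess-map φ x (y ∷ w) e = ≡.cong₂ ℕ._+_ (≡.cong (λ b → if b then 1 else 0) (e (here ≡.refl)))
                                        (countLess-map φ x w (e ∘ there))

map-cong-∈ : ∀ {f g : ℕ → ℕ} w → (∀ {x} → x ∈ w → f x ≡ g x) → map f w ≡ map g w
map-cong-∈ w e = Listₚ.map-cong-local (All.tabulate e)

red-map : ∀ φ w → PreservesOrder φ w → red (map φ w) ≡ red w
red-map φ w e = ≡.trans (≡.sym (Listₚ.map-∘ w))
  (map-cong-∈ w (λ {x} m → ≡.cong suc (countLess-map φ x w (e m))))

des-map : ∀ φ w → PreservesOrder φ w → des (map φ w) ≡ des w
des-map φ []          e = ≡.refl
des-map φ (x ∷ [])    e = ≡.refl
des-map φ (x ∷ y ∷ w) e = ≡.cong₂ ℕ._+_ (≡.cong (λ b → if b then 1 else 0) (e (here ≡.refl) (there (here ≡.refl))))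
                                    (des-map φ (y ∷ w) (λ i j → e (there i) (there j)))

inv-map : ∀ φ w → PreservesOrder φ w → inv (map φ w) ≡ inv w
inv-map φ []      e = ≡.refl
inv-map φ (x ∷ w) e = ≡.cong₂ ℕ._+_ (countLess-map φ x w (e (here ≡.refl) ∘ there))
                                (inv-map φ w (λ i j → e (there i) (there j)))

∈-take : ∀ n {x} {w : List ℕ} → x ∈ take n w → x ∈ w
∈-take (suc n) {w = _ ∷ _} (here e)  = here e
∈-take (suc n) {w = _ ∷ _} (there m) = there (∈-take n m)

∈-drop : ∀ n {x} {w : List ℕ} → x ∈ drop n w → x ∈ w
∈-drop zero    m = m
∈-drop (suc n) {w = _ ∷ _} m = there (∈-drop n m)

map-Unique : ∀ (f : ℕ → ℕ) w → (∀ {x y} → x ∈ w → y ∈ w → f x ≡ f y → x ≡ y) → Unique w → Unique (map f w)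
map-Unique f []      inj []      = []
map-Unique f (x ∷ w) inj (a ∷ u) =
  All.tabulate (λ m e → let (y , y∈ , eq) = ∈-map⁻ f m in
    All.lookup a y∈ (inj (here ≡.refl) (there y∈) (≡.trans e eq)))
  ∷ map-Unique f w (λ i j → inj (there i) (there j)) u

countLess-mono-≤ : ∀ {x y} w → x ≤ y → countLess x w ≤ countLess y w
countLess-mono-≤ []      l = z≤n
countLess-mono-≤ {x} {y} (v ∷ w) l with v <? x
... | yes v<x rewrite dec-true (v <? x) v<x | dec-true (v <? y) (ℕₚ.<-≤-trans v<x l) = s≤s (countLess-mono-≤ w l)
... | no  v≮x rewrite dec-false (v <? x) v≮x = ℕₚ.≤-trans (countLess-mono-≤ w l) (ℕₚ.m≤n+m _ _)

countLess-mono-< : ∀ {x y} w → x ∈ w → x < y → countLess x w < countLess y w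
countLess-mono-< {x} {y} (v ∷ w) (here ≡.refl) l
  rewrite dec-false (x <? x) (ℕₚ.<-irrefl ≡.refl) | dec-true (x <? y) l = s≤s (countLess-mono-≤ w (ℕₚ.<⇒≤ l))
countLess-mono-< {x} {y} (v ∷ w) (there m) l = ℕₚ.+-mono-≤-< (first v) (countLess-mono-< w m l)
  where
  first : ∀ v → (if v <ᵇ x then 1 else 0) ≤ (if v <ᵇ y then 1 else 0)
  first v with v <? x
  ... | yes v<x rewrite dec-true (v <? x) v<x | dec-true (v <? y) (ℕₚ.<-trans v<x l) = ℕₚ.≤-refl
  ... | no  v≮x rewrite dec-false (v <? x) v≮x = z≤n

countLess≤length : ∀ x w → countLess x w ≤ length w
countLess≤length x []      = z≤n
countLess≤length x (v ∷ w) with v <ᵇ x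
... | true  = s≤s (countLess≤length x w)
... | false = ℕₚ.m≤n⇒m≤1+n (countLess≤length x w)

countLess<length : ∀ {x} w → x ∈ w → countLess x w < length w
countLess<length {x} w m = ℕₚ.<-≤-trans (countLess-mono-< w m (ℕₚ.n<1+n x)) (countLess≤length (suc x) w)

-- `red w` is `map (rank w) w` by definition. As `rank w` preserves the order on w, matches of w and
-- of its reduction correspond.
rank : List ℕ → ℕ → ℕ
rank w x = suc (countLess x w)

rank-preserves : ∀ w → PreservesOrder (rank w) w
rank-preserves w {x} {y} x∈ y∈ = reflects-monotone (rank w) x y
  (λ l → s≤s (countLess-mono-< w x∈ l)) (λ l → s≤s (countLess-mono-< w y∈ l))

rank-injective : ∀ w {x y} → x ∈ w → y ∈ w → rank w x ≡ rank w y → x ≡ y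
rank-injective w {x} {y} x∈ y∈ e with ℕₚ.<-cmp x y
... | tri< l _ _ = contradiction (ℕₚ.suc-injective e) (ℕₚ.<⇒≢ (countLess-mono-< w x∈ l))
... | tri≈ _ q _ = q
... | tri> _ _ l = contradiction (≡.sym (ℕₚ.suc-injective e)) (ℕₚ.<⇒≢ (countLess-mono-< w y∈ l))

red-IsPerm : ∀ w → Unique w → IsPerm (length w) (red w)
red-IsPerm w u = Listₚ.length-map (rank w) w
  , All.tabulate (λ m → let (y , y∈ , eq) = ∈-map⁻ (rank w) m in
      ≡.subst (λ v → (1 ≤ v) × (v ≤ length w)) (≡.sym eq) (s≤s z≤n , countLess<length w y∈))
  , map-Unique (rank w) w (rank-injective w) u

module _ {P : ℕ → Set} (P? : Decidable P) where

  private
    count : ℕ → ℕ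
    count n = length (filter P? (upTo n))

    count-suc : ∀ n → count (suc n) ≡ count n ℕ.+ length (filter P? [ n ])
    count-suc n = ≡.trans (≡.cong (length ∘ filter P?) (≡.sym (Listₚ.upTo-∷ʳ n)))
      (≡.trans (≡.cong length (Listₚ.filter-++ P? (upTo n) [ n ])) (Listₚ.length-++ (filter P? (upTo n))))

    count-accept : ∀ n → P n → count (suc n) ≡ suc (count n)
    count-accept n p = ≡.trans (count-suc n)
      (≡.trans (≡.cong (λ l → count n ℕ.+ length l) (Listₚ.filter-accept P? p)) (ℕₚ.+-comm (count n) 1))

    count-reject : ∀ n → ¬ P n → count (suc n) ≡ count n
    count-reject n ¬p = ≡.trans (count-suc n)
      (≡.trans (≡.cong (λ l → count n ℕ.+ length l) (Listₚ.filter-reject P? ¬p)) (ℕₚ.+-identityʳ (count n)))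

  exactly-two : ∀ {d n} → 0 < d → d < n → P 0 → P d → (∀ k → P k → (k ≡ 0) ⊎ (k ≡ d)) → count n ≡ 2
  exactly-two {d} {suc n} 0<d (s≤s d≤n) P0 Pd only = after n d≤n
    where
    before : ∀ m → m < d → count (suc m) ≡ 1
    before zero    _ = count-accept 0 P0
    before (suc m) l = ≡.trans (count-reject (suc m) (λ p → case (only (suc m) p)))
                             (before m (ℕₚ.<-trans (ℕₚ.n<1+n m) l))
      where
      case : (suc m ≡ 0) ⊎ (suc m ≡ d) → ⊥
      case (inj₂ e) = ℕₚ.<⇒≢ l e
    after : ∀ m → d ≤ m → count (suc m) ≡ 2
    after zero    d≤0 = contradiction d≤0 (ℕₚ.<⇒≱ 0<d)
    after (suc m) l with suc m ≟ d
    ... | yes ≡.refl = ≡.trans (count-accept (suc m) Pd) (≡.cong suc (before m ℕₚ.≤-refl))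
    ... | no  m≢d  = ≡.trans (count-reject (suc m) (λ p → case (only (suc m) p)))
                           (after m (ℕₚ.≤-pred (ℕₚ.≤∧≢⇒< l (m≢d ∘ ≡.sym))))
      where
      case : (suc m ≡ 0) ⊎ (suc m ≡ d) → ⊥
      case (inj₂ e) = m≢d e

-- Overlaps of matches

Tight : List ℕ → Set
Tight τ = ∀ i σ → i < length τ ℕ.+ length τ ∸ 1 → IsPerm i σ → numMatches τ σ ≡ 2 → ⊥

module Matches (τ : List ℕ) (0<p : 0 < length τ) where

  p : ℕ
  p = length τ

  Match : List ℕ → ℕ → Set
  Match σ k = red (take p (drop k σ)) ≡ τ

  match? : ∀ σ k → Dec (Match σ k)
  match? σ k = Listₚ.≡-dec _≟_ (red (take p (drop k σ))) τ

  -- `take` and `drop` truncate silently, but `red` keeps the length, so a window running past the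
  -- end is too short to reduce to τ.
  match-fits : ∀ σ k → Match σ k → k ℕ.+ p ≤ length σ
  match-fits σ k e = ≡.subst (_≤ length σ) (ℕₚ.+-comm p k) (ℕₚ.m≤o∸n⇒m+n≤o p k≤n p≤n∸k)
    where
    window-length : p ℕ.⊓ (length σ ∸ k) ≡ p
    window-length = ≡.trans (≡.sym (≡.trans (Listₚ.length-take p (drop k σ)) (≡.cong (p ℕ.⊓_) (Listₚ.length-drop k σ))))
      (≡.trans (≡.sym (Listₚ.length-map _ (take p (drop k σ)))) (≡.cong length e))
    p≤n∸k : p ≤ length σ ∸ k
    p≤n∸k = ℕₚ.m⊓n≡m⇒m≤n window-length
    k≤n : k ≤ length σ
    k≤n with ℕₚ.≤-total k (length σ)
    ... | inj₁ l = l
    ... | inj₂ l = contradiction (≡.subst (p ≤_) (ℕₚ.m≤n⇒m∸n≡0 l) p≤n∸k) (ℕₚ.<⇒≱ 0<p)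

  match-map : ∀ φ σ k → PreservesOrder φ σ → red (take p (drop k (map φ σ))) ≡ red (take p (drop k σ))
  match-map φ σ k e = ≡.trans
    (≡.cong red (≡.trans (≡.cong (take p) (Listₚ.drop-map {f = φ} k σ)) (Listₚ.take-map {f = φ} p (drop k σ))))
    (red-map φ (take p (drop k σ)) (λ i j → e (∈-drop k (∈-take p i)) (∈-drop k (∈-take p j))))

  match-take : ∀ i σ k → k ℕ.+ p ≤ i → red (take p (drop k (take i σ))) ≡ red (take p (drop k σ))
  match-take i σ k l = ≡.cong red (≡.trans (Listₚ.take-drop p k (take i σ))
    (≡.trans (≡.cong (drop k) (≡.trans (Listₚ.take-take (k ℕ.+ p) i σ) (≡.cong (λ m → take m σ) (ℕₚ.m≤n⇒m⊓n≡m l))))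
           (≡.sym (Listₚ.take-drop p k σ))))

  numMatches-map : ∀ φ σ → PreservesOrder φ σ → numMatches τ (map φ σ) ≡ numMatches τ σ
  numMatches-map φ σ e = ≡.cong length (≡.trans
    (≡.cong (λ n → filter (match? (map φ σ)) (upTo n)) (Listₚ.length-map φ σ))
    (Listₚ.filter-≐ (match? (map φ σ)) (match? σ)
      ((λ {k} → ≡.trans (≡.sym (match-map φ σ k e))) , (λ {k} → ≡.trans (match-map φ σ k e))) (upTo (length σ))))

  noMatch⇒ : ∀ σ → numMatches τ σ ≡ 0 → ∀ k → ¬ Match σ k
  noMatch⇒ σ e k m = empty e (∈-filter⁺ (match? σ) {xs = upTo (length σ)}
    (∈-upTo⁺ (ℕₚ.<-≤-trans (ℕₚ.m<m+n k 0<p) (match-fits σ k m))) m)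
    where
    empty : ∀ {xs : List ℕ} {x} → length xs ≡ 0 → ¬ (x ∈ xs)
    empty () (here _)
    empty () (there _)

  noMatch⇐ : ∀ σ → (∀ k → ¬ Match σ k) → numMatches τ σ ≡ 0
  noMatch⇐ σ n = ≡.cong length (Listₚ.filter-none (match? σ) {upTo (length σ)} (All.tabulate (λ {k} _ → n k)))

  noMatch-take⇒ : ∀ i σ → numMatches τ (take i σ) ≡ 0 → ∀ k → k ℕ.+ p ≤ i → ¬ Match σ k
  noMatch-take⇒ i σ e k l m = noMatch⇒ (take i σ) e k (≡.trans (match-take i σ k l) m)

  noMatch-take⇐ : ∀ i σ → (∀ k → k ℕ.+ p ≤ i → ¬ Match σ k) → numMatches τ (take i σ) ≡ 0
  noMatch-take⇐ i σ n = noMatch⇐ (take i σ) λ k m →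
    let l = ℕₚ.≤-trans (match-fits (take i σ) k m)
              (≡.subst (_≤ i) (≡.sym (Listₚ.length-take i σ)) (ℕₚ.m⊓n≤m i (length σ)))
    in n k l (≡.trans (≡.sym (match-take i σ k l)) m)

  module _ (tight : Tight τ) where

    private
      -- At minimal d no further match fits between the two, so their union reduces to a permutation
      -- shorter than 2p - 1 with exactly two matches.
      close-at-zero : ∀ d → 0 < d → d < p ∸ 1 → ∀ σ → Unique σ → Match σ 0 → Match σ d → ⊥
      close-at-zero = <-rec _ step
        where
        step : ∀ d → (∀ {d′} → d′ < d → 0 < d′ → d′ < p ∸ 1 → ∀ σ → Unique σ → Match σ 0 → Match σ d′ → ⊥) →
               0 < d → d < p ∸ 1 → ∀ σ → Unique σ → Match σ 0 → Match σ d → ⊥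
        step d rec 0<d d<p-1 σ u m0 md = tight (length σ′) (red σ′) short (red-IsPerm σ′ u′)
          (≡.trans (numMatches-map (rank σ′) σ′ (rank-preserves σ′))
            (exactly-two (match? σ′) 0<d (ℕₚ.<-≤-trans (ℕₚ.m<m+n d 0<p) (ℕₚ.≤-reflexive (≡.sym len)))
              (≡.trans (match-take (d ℕ.+ p) σ 0 (ℕₚ.m≤n+m p d)) m0)
              (≡.trans (match-take (d ℕ.+ p) σ d ℕₚ.≤-refl) md) only))
          where
          σ′ : List ℕ
          σ′ = take (d ℕ.+ p) σ
          u′ : Unique σ′
          u′ = Uniqueₚ.take⁺ (d ℕ.+ p) u
          len : length σ′ ≡ d ℕ.+ p
          len = ≡.trans (Listₚ.length-take (d ℕ.+ p) σ) (ℕₚ.m≤n⇒m⊓n≡m (match-fits σ d md))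
          short : length σ′ < p ℕ.+ p ∸ 1
          short = ≡.subst (_< p ℕ.+ p ∸ 1) (≡.sym len)
            (≡.subst (d ℕ.+ p <_) (≡.sym (ℕₚ.+-∸-comm p 0<p)) (ℕₚ.+-monoˡ-< p d<p-1))
          only : ∀ k → Match σ′ k → (k ≡ 0) ⊎ (k ≡ d)
          only zero    _ = inj₁ ≡.refl
          only (suc k) m with ℕₚ.<-cmp (suc k) d
          ... | tri≈ _ e _ = inj₂ e
          ... | tri< l _ _ = ⊥-elim (rec l (s≤s z≤n) (ℕₚ.<-trans l d<p-1) σ u m0
                 (≡.trans (≡.sym (match-take (d ℕ.+ p) σ (suc k) (ℕₚ.+-monoˡ-≤ p (ℕₚ.<⇒≤ l)))) m))
          ... | tri> _ _ l = contradiction (match-fits σ′ (suc k) m)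
                 (≡.subst (λ n → ¬ (suc k ℕ.+ p ≤ n)) (≡.sym len) (ℕₚ.<⇒≱ (ℕₚ.+-monoˡ-< p l)))

    matches-far : ∀ σ k d → 0 < d → d < p ∸ 1 → Unique σ → Match σ k → Match σ (k ℕ.+ d) → ⊥
    matches-far σ k d 0<d d<p-1 u m m′ = close-at-zero d 0<d d<p-1 (drop k σ) (Uniqueₚ.drop⁺ k u) m
      (≡.trans (≡.cong (λ ρ → red (take p ρ)) (Listₚ.drop-drop k d σ)) m′)

    -- A match among the first a + p - 1 values starts before a. By `matches-far` it starts at least
    -- p - 1 earlier, hence lies within the first a + 1 values.
    noMatch-before-match : ∀ σ a → Unique σ → Match σ a →
      numMatches τ (take (suc a) σ) ≡ 0 → numMatches τ (take (a ℕ.+ (p ∸ 1)) σ) ≡ 0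
    noMatch-before-match σ a u m e = noMatch-take⇐ (a ℕ.+ (p ∸ 1)) σ λ k l mk →
      let k<a : k < a
          k<a = ℕₚ.+-cancelʳ-≤ (p ∸ 1) (suc k) a (≡.subst (_≤ a ℕ.+ (p ∸ 1)) (shift k) l)
          k+d≡a : k ℕ.+ (a ∸ k) ≡ a
          k+d≡a = ℕₚ.m+[n∸m]≡n (ℕₚ.<⇒≤ k<a)
          far : ¬ (a ∸ k < p ∸ 1)
          far d<p-1 = matches-far σ k (a ∸ k) (ℕₚ.m<n⇒0<n∸m k<a) d<p-1 u mk (≡.subst (Match σ) (≡.sym k+d≡a) m)
          fits : k ℕ.+ p ≤ suc a
          fits = ≡.subst₂ _≤_ (≡.sym (shift k)) (≡.cong suc k+d≡a)
                   (s≤s (ℕₚ.+-monoʳ-≤ k (ℕₚ.≮⇒≥ far)))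
      in noMatch-take⇒ (suc a) σ e k fits mk
      where
      shift : ∀ k → k ℕ.+ p ≡ suc k ℕ.+ (p ∸ 1)
      shift k = ≡.trans (≡.cong (k ℕ.+_) (≡.sym (ℕₚ.m+[n∸m]≡n 0<p))) (ℕₚ.+-suc k (p ∸ 1))

-- Permutation statistics of shuffles

posL-mono : ∀ w → StrictlyMonotone (posL w)
posL-mono []          l                     = l
posL-mono (false ∷ w) {zero} {suc y} _      = s≤s z≤n
posL-mono (false ∷ w) {suc x} {suc y} (s≤s l) = s≤s (posL-mono w l)
posL-mono (true ∷ w)  l                     = s≤s (posL-mono w l)

posR-mono : ∀ w → StrictlyMonotone (posR w)
posR-mono []          l                     = l
posR-mono (true ∷ w)  {zero} {suc y} _      = s≤s z≤n
posR-mono (true ∷ w)  {suc x} {suc y} (s≤s l) = s≤s (posR-mono w l)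
posR-mono (false ∷ w) l                     = s≤s (posR-mono w l)

posL≢posR : ∀ w {b} c → b < lefts w → posL w b ≢ posR w c
posL≢posR (false ∷ w) {suc b} c       (s≤s l) e = posL≢posR w c l (ℕₚ.suc-injective e)
posL≢posR (true ∷ w)  {b}     (suc c) l       e = posL≢posR w c l (ℕₚ.suc-injective e)

posR-min : ∀ w y → posR w 0 ≤ posR w y
posR-min w zero    = ℕₚ.≤-refl
posR-min w (suc y) = ℕₚ.<⇒≤ (posR-mono w (s≤s z≤n))

bit : Bool → ℕ
bit b = if b then 1 else 0

countLess-↭ : ∀ x {w w′} → w ↭ w′ → countLess x w ≡ countLess x w′
countLess-↭ x Perm.refl        = ≡.refl
countLess-↭ x (prep y p)       = ≡.cong (bit (y <ᵇ x) ℕ.+_) (countLess-↭ x p)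
countLess-↭ x (swap y z p)     rewrite countLess-↭ x p =
  swap-+ (bit (y <ᵇ x)) (bit (z <ᵇ x)) _
  where
  swap-+ : ∀ a b c → a ℕ.+ (b ℕ.+ c) ≡ b ℕ.+ (a ℕ.+ c)
  swap-+ = solve-∀
countLess-↭ x (Perm.trans p q) = ≡.trans (countLess-↭ x p) (countLess-↭ x q)

countLess-suc : ∀ x w → countLess (suc x) (map suc w) ≡ countLess x w
countLess-suc x w = countLess-map suc x w (λ _ → ≡.refl)

countLess-zero : ∀ w → countLess 0 w ≡ 0
countLess-zero []      = ≡.refl
countLess-zero (x ∷ w) = countLess-zero w

countLess-above : ∀ x w → (∀ {y} → y ∈ w → x < y) → countLess x w ≡ 0
countLess-above x []      a = ≡.refl
countLess-above x (y ∷ w) a rewrite dec-false (y <? x) (ℕₚ.<⇒≯ (a (here ≡.refl))) = countLess-above x w (a ∘ there)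

countLess-none : ∀ x w → countLess x w ≡ 0 → ∀ {y} → y ∈ w → ¬ (y < x)
countLess-none x (y ∷ w) e (here ≡.refl) l rewrite dec-true (y <? x) l = contradiction e λ ()
countLess-none x (y ∷ w) e (there m)   l = countLess-none x w (ℕₚ.m+n≡0⇒n≡0 (bit (y <ᵇ x)) e) m l

countLess-upTo : ∀ {k n} → k < n → countLess k (upTo n) ≡ k
countLess-upTo {zero}  {suc n} l       = countLess-zero (upTo (suc n))
countLess-upTo {suc k} {suc n} (s≤s l) = ≡.trans (≡.cong (countLess (suc k)) (upTo-suc n))
  (≡.cong suc (≡.trans (countLess-suc k (upTo n)) (countLess-upTo l)))

countLess-perm : ∀ {κ n k} → κ ↭ upTo n → k < n → countLess k κ ≡ k
countLess-perm p l = ≡.trans (countLess-↭ _ p) (countLess-upTo l)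

↭-upTo-length : ∀ {κ n} → κ ↭ upTo n → length κ ≡ n
↭-upTo-length {n = n} p = ≡.trans (Permₚ.↭-length p) (Listₚ.length-upTo n)

∈-perm⇒< : ∀ {κ n k} → κ ↭ upTo n → k ∈ κ → k < n
∈-perm⇒< p m = ∈-upTo⁻ (Permₚ.∈-resp-↭ p m)

cross : List ℕ → List ℕ → ℕ
cross α β = sum (map (λ x → countLess x β) α)

countLess-++ : ∀ x α β → countLess x (α ++ β) ≡ countLess x α ℕ.+ countLess x β
countLess-++ x []      β = ≡.refl
countLess-++ x (y ∷ α) β = ≡.trans (≡.cong (bit (y <ᵇ x) ℕ.+_) (countLess-++ x α β)) (≡.sym (ℕₚ.+-assoc (bit (y <ᵇ x)) _ _))

inv-++ : ∀ α β → inv (α ++ β) ≡ inv α ℕ.+ inv β ℕ.+ cross α β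
inv-++ []      β = ≡.sym (ℕₚ.+-identityʳ _)
inv-++ (x ∷ α) β rewrite countLess-++ x α β | inv-++ α β = shuffle-+ (countLess x α) (countLess x β) (inv α) _ _
  where
  shuffle-+ : ∀ a b c d e → a ℕ.+ b ℕ.+ (c ℕ.+ d ℕ.+ e) ≡ a ℕ.+ c ℕ.+ d ℕ.+ (b ℕ.+ e)
  shuffle-+ = solve-∀

cross-suc : ∀ α β → cross (map suc α) (map suc β) ≡ cross α β
cross-suc []      β = ≡.refl
cross-suc (x ∷ α) β = ≡.cong₂ ℕ._+_ (countLess-suc x β) (cross-suc α β)

cross-↭ˡ : ∀ {α α′} β → α ↭ α′ → cross α β ≡ cross α′ β
cross-↭ˡ β p = sum-↭ (Permₚ.map⁺ (λ x → countLess x β) p)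

cross-↭ʳ : ∀ α {β β′} → β ↭ β′ → cross α β ≡ cross α β′
cross-↭ʳ []      p = ≡.refl
cross-↭ʳ (x ∷ α) p = ≡.cong₂ ℕ._+_ (countLess-↭ x p) (cross-↭ʳ α p)

cross-zero : ∀ α β → cross (map suc α) (0 ∷ map suc β) ≡ length α ℕ.+ cross α β
cross-zero []      β = ≡.refl
cross-zero (x ∷ α) β rewrite countLess-suc x β | cross-zero α β = swap-+ (countLess x β) (length α) _
  where
  swap-+ : ∀ a b c → suc (a ℕ.+ (b ℕ.+ c)) ≡ suc (b ℕ.+ (a ℕ.+ c))
  swap-+ = solve-∀

cross-word : ∀ w → cross (map (posL w) (upTo (lefts w))) (map (posR w) (upTo (rights w))) ≡ winv w
cross-word []          = ≡.refl
cross-word (false ∷ w) = ≡.trans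
  (≡.cong₂ cross (map-posL-false w (lefts w)) (map-posR-false w (upTo (rights w))))
  (≡.cong₂ ℕ._+_ (countLess-zero (map suc (map (posR w) (upTo (rights w)))))
    (≡.trans (cross-suc (map (posL w) (upTo (lefts w))) (map (posR w) (upTo (rights w)))) (cross-word w)))
cross-word (true ∷ w)  = ≡.trans
  (≡.cong₂ cross (map-posL-true w (upTo (lefts w))) (map-posR-true w (rights w)))
  (≡.trans (cross-zero (map (posL w) (upTo (lefts w))) (map (posR w) (upTo (rights w))))
    (≡.cong₂ ℕ._+_ (≡.trans (Listₚ.length-map (posL w) (upTo (lefts w))) (Listₚ.length-upTo (lefts w))) (cross-word w)))

-- Monotone relabelling keeps the inversions inside a block; those across depend only on the two
-- sets of values, hence on w.
inv-shuffle : ∀ w {ρ κ} → ρ ↭ upTo (lefts w) → κ ↭ upTo (rights w) →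
              inv (map (posL w) ρ ++ map (posR w) κ) ≡ inv ρ ℕ.+ inv κ ℕ.+ winv w
inv-shuffle w {ρ} {κ} p q = ≡.trans (inv-++ (map (posL w) ρ) (map (posR w) κ))
  (≡.cong₂ ℕ._+_ (≡.cong₂ ℕ._+_ (inv-map (posL w) ρ (monotone⇒preserves ρ (posL-mono w)))
                        (inv-map (posR w) κ (monotone⇒preserves κ (posR-mono w))))
    (≡.trans (cross-↭ˡ (map (posR w) κ) (Permₚ.map⁺ (posL w) p))
      (≡.trans (cross-↭ʳ (map (posL w) (upTo (lefts w))) (Permₚ.map⁺ (posR w) q)) (cross-word w))))

final : List ℕ → ℕ
final []          = 0
final (x ∷ [])    = x
final (x ∷ y ∷ r) = final (y ∷ r)

final-map : ∀ φ {α n} → length α ≡ suc n → final (map φ α) ≡ φ (final α)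
final-map φ {x ∷ []}    {n} _ = ≡.refl
final-map φ {x ∷ y ∷ r} {n} _ = final-map φ {y ∷ r} ≡.refl

final-++ : ∀ α {β n} → length β ≡ suc n → final (α ++ β) ≡ final β
final-++ []          l = ≡.refl
final-++ (x ∷ [])    {y ∷ β} l = ≡.refl
final-++ (x ∷ y ∷ α) l = final-++ (y ∷ α) l

final-∈ : ∀ {α n} → length α ≡ suc n → final α ∈ α
final-∈ {x ∷ []}    _ = here ≡.refl
final-∈ {x ∷ y ∷ r} _ = there (final-∈ {y ∷ r} ≡.refl)

des-++ : ∀ α y β {n} → length α ≡ suc n → des (α ++ y ∷ β) ≡ des α ℕ.+ (bit (y <ᵇ final α) ℕ.+ des (y ∷ β))
des-++ (x ∷ [])     y β _ = ≡.refl
des-++ (x ∷ x′ ∷ α) y β _ = ≡.trans (≡.cong (bit (x′ <ᵇ x) ℕ.+_) (des-++ (x′ ∷ α) y β ≡.refl))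
  (≡.sym (ℕₚ.+-assoc (bit (x′ <ᵇ x)) _ _))

take-++ : ∀ {n} (α β : List ℕ) → length α ≡ n → take n (α ++ β) ≡ α
take-++ []      β ≡.refl = ≡.refl
take-++ (x ∷ α) β ≡.refl = ≡.cong (x ∷_) (take-++ α β ≡.refl)

drop-++ : ∀ {n} (α β : List ℕ) → length α ≡ suc n → drop n (α ++ β) ≡ final α ∷ β
drop-++ (x ∷ [])    β ≡.refl = ≡.refl
drop-++ (x ∷ y ∷ α) β ≡.refl = drop-++ (y ∷ α) β ≡.refl

-- As τ starts with its minimum, the window matches exactly when its first value lies below the
-- right block, whose least value is `posR w 0`, and the block has relative order κ₀.
red-shuffle : ∀ w {κ} κ₀ {b n} → b < lefts w → κ ↭ upTo (suc n) →
  does (Listₚ.≡-dec _≟_ (red (posL w b ∷ map (posR w) κ)) (1 ∷ map (2 ℕ.+_) κ₀)) ≡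
  (posL w b <ᵇ posR w 0) ∧ does (Listₚ.≡-dec _≟_ κ κ₀)
red-shuffle w {κ} κ₀ {b} {n} b<l p =
  does-⇔ (mk⇔ to from) (Listₚ.≡-dec _≟_ (red (x ∷ β)) (1 ∷ map (2 ℕ.+_) κ₀))
         ((x <? posR w 0) ×-dec Listₚ.≡-dec _≟_ κ κ₀)
  where
  x : ℕ
  x = posL w b
  β : List ℕ
  β = map (posR w) κ
  -- The rank of `posR w k` counts itself, the first value x and the k smaller values of the block:
  -- k + 2.
  red-tail : x < posR w 0 → map (λ y → suc (countLess y (x ∷ β))) β ≡ map (2 ℕ.+_) κ
  red-tail l = ≡.trans (≡.sym (Listₚ.map-∘ κ)) (map-cong-∈ κ λ {k} m →
    ≡.cong suc (≡.cong₂ ℕ._+_ (≡.cong bit (dec-true (x <? posR w k) (ℕₚ.<-≤-trans l (posR-min w k))))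
      (≡.trans (countLess-map (posR w) k κ (λ m′ → monotone⇒preserves κ (posR-mono w) m m′))
             (countLess-perm p (∈-perm⇒< p m)))))
  red-head : x < posR w 0 → countLess x (x ∷ β) ≡ 0
  red-head l rewrite dec-false (x <? x) (ℕₚ.<-irrefl ≡.refl) =
    countLess-above x β (λ m → let (k , _ , e) = ∈-map⁻ (posR w) m in ≡.subst (x <_) (≡.sym e) (ℕₚ.<-≤-trans l (posR-min w k)))
  to : red (x ∷ β) ≡ 1 ∷ map (2 ℕ.+_) κ₀ → (x < posR w 0) × (κ ≡ κ₀)
  to e = l , Listₚ.map-injective (ℕₚ.+-cancelˡ-≡ 2 _ _) (≡.trans (≡.sym (red-tail l)) (Listₚ.∷-injectiveʳ e))
    where
    l : x < posR w 0
    -- Rank 1 only says that nothing in the block is smaller than x; strictness comes from left and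
    -- right values being different.
    l = ℕₚ.≤∧≢⇒< (ℕₚ.≮⇒≥ (countLess-none x (x ∷ β) (ℕₚ.suc-injective (Listₚ.∷-injectiveˡ e))
          (there (∈-map⁺ (posR w) (Permₚ.∈-resp-↭ (↭-sym p) (here ≡.refl)))))) (posL≢posR w 0 b<l)
  from : (x < posR w 0) × (κ ≡ κ₀) → red (x ∷ β) ≡ 1 ∷ map (2 ℕ.+_) κ₀
  from (l , ≡.refl) = ≡.cong₂ _∷_ (≡.cong suc (red-head l)) (red-tail l)

module Shuffle (w : List Bool) {ρ κ : List ℕ} {m n : ℕ} (ρ↭ : ρ ↭ upTo (suc m)) (κ↭ : κ ↭ upTo (suc n)) where

  shuffled : List ℕ
  shuffled = map (posL w) ρ ++ map (posR w) κ

  lengthˡ : length (map (posL w) ρ) ≡ suc m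
  lengthˡ = ≡.trans (Listₚ.length-map (posL w) ρ) (↭-upTo-length ρ↭)

  lengthʳ : length (map (posR w) κ) ≡ suc n
  lengthʳ = ≡.trans (Listₚ.length-map (posR w) κ) (↭-upTo-length κ↭)

  finalˡ : final (map (posL w) ρ) ≡ posL w (final ρ)
  finalˡ = final-map (posL w) {ρ} (↭-upTo-length ρ↭)

  final-shuffled : final shuffled ≡ posR w (final κ)
  final-shuffled = ≡.trans (final-++ (map (posL w) ρ) lengthʳ) (final-map (posR w) {κ} (↭-upTo-length κ↭))

  take-shuffled : take (suc m) shuffled ≡ map (posL w) ρ
  take-shuffled = take-++ (map (posL w) ρ) (map (posR w) κ) lengthˡ

  drop-shuffled : drop m shuffled ≡ posL w (final ρ) ∷ map (posR w) κ
  drop-shuffled = ≡.trans (drop-++ (map (posL w) ρ) (map (posR w) κ) lengthˡ) (≡.cong (_∷ map (posR w) κ) finalˡ)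

  inv-shuffled : lefts w ≡ suc m → rights w ≡ suc n → inv shuffled ≡ inv ρ ℕ.+ inv κ ℕ.+ winv w
  inv-shuffled l r = inv-shuffle w (≡.subst (λ i → ρ ↭ upTo i) (≡.sym l) ρ↭) (≡.subst (λ i → κ ↭ upTo i) (≡.sym r) κ↭)

des-shuffle : ∀ w {ρ} y κ {m} → ρ ↭ upTo (suc m) → des (map (posL w) ρ ++ map (posR w) (y ∷ κ)) ≡
              des ρ ℕ.+ (bit (posR w y <ᵇ posL w (final ρ)) ℕ.+ des (y ∷ κ))
des-shuffle w {ρ} y κ ρ↭ = ≡.trans
  (des-++ (map (posL w) ρ) (posR w y) (map (posR w) κ) (≡.trans (Listₚ.length-map (posL w) ρ) (↭-upTo-length ρ↭)))
  (≡.cong₂ ℕ._+_ (des-map (posL w) ρ (monotone⇒preserves ρ (posL-mono w)))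
    (≡.cong₂ ℕ._+_ (≡.cong (λ v → bit (posR w y <ᵇ v)) (final-map (posL w) {ρ} (↭-upTo-length ρ↭)))
               (des-map (posR w) (y ∷ κ) (monotone⇒preserves (y ∷ κ) (posR-mono w)))))

-- The link between the blocks is an ascent, so it adds no descent.
des-shuffle-above : ∀ w {ρ κ m n} → ρ ↭ upTo (suc m) → κ ↭ upTo (suc n) → posL w (final ρ) < posR w 0 →
                    des (map (posL w) ρ ++ map (posR w) κ) ≡ des ρ ℕ.+ des κ
des-shuffle-above w {ρ} {[]}    ρ↭ κ↭ l = contradiction (↭-upTo-length κ↭) λ ()
des-shuffle-above w {ρ} {y ∷ κ} ρ↭ κ↭ l = ≡.trans (des-shuffle w y κ ρ↭)
  (≡.cong (λ b → des ρ ℕ.+ (bit b ℕ.+ des (y ∷ κ)))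
    (dec-false (posR w y <? posL w (final ρ)) (ℕₚ.<⇒≯ (ℕₚ.<-≤-trans l (posR-min w y)))))

-- Gaussian binomial coefficients

module QFactorials (R : CommutativeRing 0ℓ 0ℓ) (q : CommutativeRing.Carrier R) where
  open CommutativeRing R hiding (zero)
  open NatSolver commutativeSemiring using (solve; _:=_; _:+_; _:*_)
  open Exp semiring using (_^_; ^-homo-*)

  qnum : ℕ → Carrier
  qnum zero    = 0#
  qnum (suc n) = 1# + q * qnum n

  fact : ℕ → Carrier
  fact zero    = 1#
  fact (suc n) = fact n * qnum (suc n)

  InvertsFact : (ℕ → Carrier) → Set
  InvertsFact f = ∀ n → fact n * f n ≈ 1#

  qnum-+ : ∀ a b → qnum (a ℕ.+ b) ≈ qnum a + q ^ a * qnum b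
  qnum-+ zero    b = sym (trans (+-identityˡ _) (*-identityˡ _))
  qnum-+ (suc a) b = trans (+-congˡ (*-congˡ (qnum-+ a b)))
    (solve 5 (λ o q x y z → o :+ q :* (x :+ y :* z) := (o :+ q :* x) :+ (q :* y) :* z) refl _ _ _ _ _)

module Gauss (R : CommutativeRing 0ℓ 0ℓ) (q : CommutativeRing.Carrier R)
  (fact⁻¹ : ℕ → CommutativeRing.Carrier R)
  (fact-inverse : QFactorials.InvertsFact R q fact⁻¹) where
  open CommutativeRing R hiding (zero)
  open NatSolver commutativeSemiring using (solve; _:=_; _:+_; _:*_)
  open Exp semiring using (_^_; ^-homo-*)
  open QFactorials R q public
  open import Relation.Binary.Reasoning.Setoid setoid

  -- the Gaussian binomial coefficient [a+b choose a]
  gauss : ℕ → ℕ → Carrier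
  gauss a b = fact (a ℕ.+ b) * (fact⁻¹ a * fact⁻¹ b)

  private
    fact⁻¹-zero : fact⁻¹ 0 ≈ 1#
    fact⁻¹-zero = trans (sym (*-identityˡ _)) (fact-inverse 0)

    fact⁻¹-suc : ∀ n → qnum (suc n) * fact⁻¹ (suc n) ≈ fact⁻¹ n
    fact⁻¹-suc n = begin
      qnum (suc n) * fact⁻¹ (suc n)                          ≈⟨ sym (*-identityˡ _) ⟩
      1# * (qnum (suc n) * fact⁻¹ (suc n))                   ≈⟨ *-congʳ (sym (fact-inverse n)) ⟩
      fact n * fact⁻¹ n * (qnum (suc n) * fact⁻¹ (suc n))
        ≈⟨ solve 4 (λ a b c d → a :* b :* (c :* d) := (a :* c :* d) :* b) refl _ _ _ _ ⟩
      fact (suc n) * fact⁻¹ (suc n) * fact⁻¹ n               ≈⟨ *-congʳ (fact-inverse (suc n)) ⟩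
      1# * fact⁻¹ n                                          ≈⟨ *-identityˡ _ ⟩
      fact⁻¹ n ∎

  gauss-zeroˡ : ∀ b → gauss 0 b ≈ 1#
  gauss-zeroˡ b = trans (*-congˡ (trans (*-congʳ fact⁻¹-zero) (*-identityˡ _))) (fact-inverse b)

  gauss-comm : ∀ a b → gauss a b ≈ gauss b a
  gauss-comm a b = *-cong (reflexive (≡.cong fact (ℕₚ.+-comm a b))) (*-comm _ _)

  gauss-zeroʳ : ∀ a → gauss a 0 ≈ 1#
  gauss-zeroʳ a = trans (gauss-comm a 0) (gauss-zeroˡ a)

  -- Write [a+b+2] as [a+1] + q^(a+1) [b+1]; each summand cancels against one of the inverse
  -- factorials.
  gauss-pascal : ∀ a b → gauss (suc a) (suc b) ≈ gauss a (suc b) + q ^ suc a * gauss (suc a) b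
  gauss-pascal a b = begin
    fact (a ℕ.+ suc b) * qnum (suc a ℕ.+ suc b) * (fact⁻¹ (suc a) * fact⁻¹ (suc b))
      ≈⟨ *-congʳ (*-congˡ (qnum-+ (suc a) (suc b))) ⟩
    fact (a ℕ.+ suc b) * (qnum (suc a) + q ^ suc a * qnum (suc b)) * (fact⁻¹ (suc a) * fact⁻¹ (suc b))
      ≈⟨ solve 6 (λ f x y z u v → f :* (x :+ y :* z) :* (u :* v)
                   := f :* ((x :* u) :* v) :+ y :* (f :* (u :* (z :* v)))) refl _ _ _ _ _ _ ⟩
    fact (a ℕ.+ suc b) * ((qnum (suc a) * fact⁻¹ (suc a)) * fact⁻¹ (suc b)) +
    q ^ suc a * (fact (a ℕ.+ suc b) * (fact⁻¹ (suc a) * (qnum (suc b) * fact⁻¹ (suc b))))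
      ≈⟨ +-cong (*-congˡ (*-congʳ (fact⁻¹-suc a)))
                (*-congˡ (*-cong (reflexive (≡.cong fact (ℕₚ.+-suc a b))) (*-congˡ (fact⁻¹-suc b)))) ⟩
    gauss a (suc b) + q ^ suc a * gauss (suc a) b ∎

  -- Both sides are the q-trinomial [g+k+r]! / ([g]! [k]! [r]!).
  gauss-trinomial : ∀ g k r → gauss g k * gauss (g ℕ.+ k) r ≈ gauss r k * gauss g (r ℕ.+ k)
  gauss-trinomial g k r = begin
    fact (g ℕ.+ k) * (fact⁻¹ g * fact⁻¹ k) * (fact (g ℕ.+ k ℕ.+ r) * (fact⁻¹ (g ℕ.+ k) * fact⁻¹ r))
      ≈⟨ solve 6 (λ a a′ b c d e → a :* (b :* c) :* (d :* (a′ :* e)) := (a :* a′) :* (b :* (c :* (d :* e)))) refl _ _ _ _ _ _ ⟩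
    (fact (g ℕ.+ k) * fact⁻¹ (g ℕ.+ k)) * (fact⁻¹ g * (fact⁻¹ k * (fact (g ℕ.+ k ℕ.+ r) * fact⁻¹ r)))
      ≈⟨ *-cong (trans (fact-inverse (g ℕ.+ k)) (sym (fact-inverse (r ℕ.+ k))))
                (*-congˡ (*-congˡ (*-congʳ (reflexive (≡.cong fact
                  (≡.trans (ℕₚ.+-assoc g k r) (≡.cong (g ℕ.+_) (ℕₚ.+-comm k r)))))))) ⟩
    (fact (r ℕ.+ k) * fact⁻¹ (r ℕ.+ k)) * (fact⁻¹ g * (fact⁻¹ k * (fact (g ℕ.+ (r ℕ.+ k)) * fact⁻¹ r)))
      ≈⟨ solve 6 (λ a a′ b c d e → (a :* a′) :* (b :* (c :* (d :* e))) := a :* (e :* c) :* (d :* (b :* a′))) refl _ _ _ _ _ _ ⟩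
    gauss r k * gauss g (r ℕ.+ k) ∎

  module WordSums (z y : Carrier) (z+y≈1 : z + y ≈ 1#) where
    open ArrangementSums R

    -- The classical count of words by inversions: splitting by the first letter is Pascal's rule,
    -- as a leading `true` is inverted with all g lefts.
    bits-winv : ∀ g k → bits g k (λ w → q ^ winv w) ≈ gauss g k
    bits-winv-true : ∀ g k → bits g k (λ w → q ^ winv (true ∷ w)) ≈ q ^ g * gauss g k

    bits-winv-true g k = trans
      (bits-cong g k (λ { w ≡.refl _ → ^-homo-* q (lefts w) (winv w) }))
      (trans (bits-*ˡ g k (q ^ g) _) (*-congˡ (bits-winv g k)))

    bits-winv zero    zero    = sym (gauss-zeroˡ 0)
    bits-winv (suc g) zero    = trans (bits-winv g zero) (trans (gauss-zeroʳ g) (sym (gauss-zeroʳ (suc g))))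
    bits-winv zero    (suc k) = trans (bits-winv-true zero k) (trans (*-identityˡ _)
      (trans (gauss-zeroˡ k) (sym (gauss-zeroˡ (suc k)))))
    bits-winv (suc g) (suc k) = trans (+-cong (bits-winv g (suc k)) (bits-winv-true (suc g) k))
      (sym (gauss-pascal g k))

    -- The inner Gaussian binomial interleaves r new values with those above the marked right value.
    -- Equivalently, interleave them first with the k - c right values above the mark, then shuffle
    -- the g left values with the r + k + 1 others. The proof peels off letters until the mark is
    -- the smallest value, where `gauss-trinomial` applies.
    bits-marked : ∀ g k c r → c ≤ k →
      bits g (suc k) (λ w → q ^ winv w * gauss ((g ℕ.+ suc k) ∸ suc (posR w c)) r) ≈
      gauss r (k ∸ c) * gauss g (suc (r ℕ.+ k))
    bits-marked-true : ∀ g k c r → c ≤ k →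
      bits g k (λ w → q ^ winv (true ∷ w) * gauss ((g ℕ.+ suc k) ∸ suc (posR (true ∷ w) c)) r) ≈
      q ^ g * (gauss r (k ∸ c) * gauss g (r ℕ.+ k))

    bits-marked-true g k zero r c≤k = begin
      bits g k (λ w → q ^ winv (true ∷ w) * gauss ((g ℕ.+ suc k) ∸ 1) r)
        ≈⟨ bits-cong g k (λ w _ _ → trans (*-comm _ _)
             (*-congʳ (reflexive (≡.cong (λ n → gauss (n ∸ 1) r) (ℕₚ.+-suc g k))))) ⟩
      bits g k (λ w → gauss (g ℕ.+ k) r * q ^ winv (true ∷ w))
        ≈⟨ trans (bits-*ˡ g k _ _) (*-congˡ (bits-winv-true g k)) ⟩
      gauss (g ℕ.+ k) r * (q ^ g * gauss g k)
        ≈⟨ solve 3 (λ a b c → a :* (b :* c) := b :* (c :* a)) refl _ _ _ ⟩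
      q ^ g * (gauss g k * gauss (g ℕ.+ k) r)
        ≈⟨ *-congˡ (gauss-trinomial g k r) ⟩
      q ^ g * (gauss r k * gauss g (r ℕ.+ k)) ∎
    bits-marked-true g (suc k) (suc c) r (s≤s c≤k) = begin
      bits g (suc k) (λ w → q ^ winv (true ∷ w) * gauss ((g ℕ.+ suc (suc k)) ∸ suc (suc (posR w c))) r)
        ≈⟨ bits-cong g (suc k) (λ { w ≡.refl _ → trans
             (*-cong (^-homo-* q (lefts w) (winv w))
               (reflexive (≡.cong (λ n → gauss (n ∸ suc (suc (posR w c))) r) (ℕₚ.+-suc (lefts w) (suc k)))))
             (*-assoc _ _ _) }) ⟩
      bits g (suc k) (λ w → q ^ g * (q ^ winv w * gauss ((g ℕ.+ suc k) ∸ suc (posR w c)) r))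
        ≈⟨ trans (bits-*ˡ g (suc k) _ _) (*-congˡ (bits-marked g k c r c≤k)) ⟩
      q ^ g * (gauss r (k ∸ c) * gauss g (suc (r ℕ.+ k)))
        ≈⟨ *-congˡ (*-congˡ (reflexive (≡.cong (gauss g) (≡.sym (ℕₚ.+-suc r k))))) ⟩
      q ^ g * (gauss r (k ∸ c) * gauss g (r ℕ.+ suc k)) ∎

    bits-marked zero k c r c≤k = trans (bits-marked-true zero k c r c≤k) (trans (*-identityˡ _)
      (*-congˡ (trans (gauss-zeroˡ (r ℕ.+ k)) (sym (gauss-zeroˡ (suc (r ℕ.+ k)))))))
    bits-marked (suc g) k c r c≤k = trans
      (+-cong (bits-marked g k c r c≤k) (bits-marked-true (suc g) k c r c≤k))
      (trans (solve 4 (λ a b c d → a :* b :+ c :* (a :* d) := a :* (b :+ c :* d)) refl _ _ _ _)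
             (*-congˡ (sym (gauss-pascal g (r ℕ.+ k)))))

    -- The condition forces the word to begin with b + 1 letters `false`, which create no
    -- inversions; `bits-marked` treats the remaining a - b lefts.
    bits-marked-above : ∀ a k b c r → b ≤ a → c ≤ k →
      bits (suc a) (suc k) (λ w → only (posL w b <ᵇ posR w 0)
        (q ^ winv w * gauss ((suc a ℕ.+ suc k) ∸ suc (posR w c)) r)) ≈
      gauss r (k ∸ c) * gauss (a ∸ b) (suc (r ℕ.+ k))
    bits-marked-above a k zero c r _ c≤k =
      trans (+-cong (bits-marked a k c r c≤k) (bits-0 (suc a) k)) (+-identityʳ _)
    bits-marked-above (suc a) k (suc b) c r (s≤s b≤a) c≤k =
      trans (+-cong (bits-marked-above a k b c r b≤a c≤k) (bits-0 (suc (suc a)) k)) (+-identityʳ _)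

    -- Each appended value receives weight z, and each ascent an additional y, completing z + y = 1.
    -- Both resulting sums are q-hockey-stick sums, one over all values and one over those making an
    -- ascent from b.
    bits-append : ∀ i b r → b < i →
      bits i 1 (λ w → q ^ winv w * (z ^ bit (posR w 0 <ᵇ posL w b) * gauss (i ∸ posR w 0) r)) ≈
      z * gauss i (suc r) + y * gauss (i ∸ suc b) (suc r)
    bits-append (suc i) b r b<i = trans (+-cong (left i b b<i) right) (trans
      (solve 4 (λ z g x y′ → (z :* g :+ y′) :+ z :* x := z :* (g :+ x) :+ y′) refl _ _ _ _)
      (+-congʳ (*-congˡ (sym (gauss-pascal i r)))))
      where
      -- Here the appended value is the smallest, hence a descent; its term completes Pascal's rule
      -- in the z part.
      right : bits (suc i) 0 (λ w → q ^ winv (true ∷ w) * (z * 1# * gauss (suc i) r)) ≈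
              z * (q ^ suc i * gauss (suc i) r)
      right = begin
        bits (suc i) 0 (λ w → q ^ winv (true ∷ w) * (z * 1# * gauss (suc i) r))
          ≈⟨ bits-cong (suc i) 0 (λ w _ _ → *-comm (q ^ winv (true ∷ w)) (z * 1# * gauss (suc i) r)) ⟩
        bits (suc i) 0 (λ w → z * 1# * gauss (suc i) r * q ^ winv (true ∷ w))
          ≈⟨ trans (bits-*ˡ (suc i) 0 _ (λ w → q ^ winv (true ∷ w))) (*-cong (*-congʳ (*-identityʳ z))
               (trans (bits-winv-true (suc i) 0) (trans (*-congˡ (gauss-zeroʳ (suc i))) (*-identityʳ _)))) ⟩
        z * gauss (suc i) r * q ^ suc i
          ≈⟨ solve 3 (λ a b c → a :* b :* c := a :* (c :* b)) refl _ _ _ ⟩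
        z * (q ^ suc i * gauss (suc i) r) ∎
      left : ∀ i b → b < suc i →
        bits i 1 (λ w → q ^ winv w * (z ^ bit (posR (false ∷ w) 0 <ᵇ posL (false ∷ w) b) * gauss (i ∸ posR w 0) r)) ≈
        z * gauss i (suc r) + y * gauss (i ∸ b) (suc r)
      left i zero    _         = begin
        bits i 1 (λ w → q ^ winv w * (1# * gauss (i ∸ posR w 0) r))
          ≈⟨ bits-cong i 1 (λ w _ _ → *-congˡ (trans (*-identityˡ _)
               (reflexive (≡.cong (λ n → gauss (n ∸ suc (posR w 0)) r) (ℕₚ.+-comm 1 i))))) ⟩
        bits i 1 (λ w → q ^ winv w * gauss ((i ℕ.+ 1) ∸ suc (posR w 0)) r)
          ≈⟨ bits-marked i 0 0 r z≤n ⟩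
        gauss r 0 * gauss i (suc (r ℕ.+ 0))
          -- The factor `gauss r 0` is 1, and is rewritten as z + y: with b the smallest old value,
          -- all appended values left are ascents.
          ≈⟨ *-cong (trans (gauss-zeroʳ r) (sym z+y≈1)) (reflexive (≡.cong (gauss i ∘ suc) (ℕₚ.+-identityʳ r))) ⟩
        (z + y) * gauss i (suc r)
          ≈⟨ distribʳ _ _ _ ⟩
        z * gauss i (suc r) + y * gauss i (suc r) ∎
      left i (suc b) (s≤s b<i) = bits-append i b r b<i

-- The recurrence over an abstract coefficient ring

perm-Unique : ∀ {n π} → π ↭ upTo n → Unique π
perm-Unique {n} p = Unique-resp-↭ (↭-sym p) (Uniqueₚ.upTo⁺ n)

module Avoidance (R : CommutativeRing 0ℓ 0ℓ) (q z y : CommutativeRing.Carrier R)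
  (z+y≈1 : CommutativeRing._≈_ R (CommutativeRing._+_ R z y) (CommutativeRing.1# R))
  (fact⁻¹ : ℕ → CommutativeRing.Carrier R)
  (fact-inverse : QFactorials.InvertsFact R q fact⁻¹)
  (κ₀ : List ℕ) (k : ℕ) (κ₀-perm : κ₀ ↭ upTo (suc k))
  (tight : Tight (1 ∷ map (2 ℕ.+_) κ₀))
  where
  open CommutativeRing R hiding (zero)
  open NatSolver commutativeSemiring using (solve; _:=_; _:+_; _:*_)
  open Exp semiring using (_^_; ^-homo-*)
  open DiagonalSums R
  open ArrangementSums R
  open Gauss R q fact⁻¹ fact-inverse
  open WordSums z y z+y≈1
  open import Relation.Binary.Reasoning.Setoid setoid

  τ : List ℕ
  τ = 1 ∷ map (2 ℕ.+_) κ₀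

  open Matches τ (s≤s z≤n)

  c : ℕ
  c = final κ₀

  κ₀-length : length κ₀ ≡ suc k
  κ₀-length = ↭-upTo-length κ₀-perm

  p≡ : p ≡ suc (suc k)
  p≡ = ≡.cong suc (≡.trans (Listₚ.length-map (2 ℕ.+_) κ₀) κ₀-length)

  c≤k : c ≤ k
  c≤k = ℕₚ.≤-pred (∈-perm⇒< κ₀-perm (final-∈ κ₀-length))

  avoids : List ℕ → Bool
  avoids σ = does (numMatches τ σ ≟ 0)

  wt : List ℕ → Carrier
  wt σ = q ^ inv σ * z ^ des σ

  N : ℕ → Carrier
  N n = perm n (λ π → only (avoids π) (wt π))

  -- N with the weight [n + r - π_n choose r], where the 0-based last value final π is π_n - 1
  A : ℕ → ℕ → Carrier
  A n r = perm n (λ π → only (avoids π) (wt π * gauss (n ∸ suc (final π)) r))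

  private
    only-*ʳ : ∀ b x y → only b (x * y) ≈ only b x * y
    only-*ʳ true  x y = refl
    only-*ʳ false x y = sym (zeroˡ y)

    weight-cong : ∀ n r {b b′ i i′ d d′ f f′} → b ≡ b′ → i ≡ i′ → d ≡ d′ → f ≡ f′ →
      only b (q ^ i * z ^ d * gauss (n ∸ suc f) r) ≡ only b′ (q ^ i′ * z ^ d′ * gauss (n ∸ suc f′) r)
    weight-cong n r ≡.refl ≡.refl ≡.refl ≡.refl = ≡.refl

    perm-1 : ∀ f → perm 1 f ≈ f (0 ∷ [])
    perm-1 f = +-identityʳ _

    avoids-short : ∀ σ → length σ < p → avoids σ ≡ true
    avoids-short σ l = dec-true (numMatches τ σ ≟ 0) (noMatch⇐ σ λ j m →
      contradiction (ℕₚ.≤-trans (ℕₚ.m≤n+m p j) (match-fits σ j m)) (ℕₚ.<⇒≱ l))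

    avoids-map : ∀ φ σ → StrictlyMonotone φ → avoids (map φ σ) ≡ avoids σ
    avoids-map φ σ m = ≡.cong (λ n → does (n ≟ 0)) (numMatches-map φ σ (monotone⇒preserves σ m))

  N-A : ∀ n → A n 0 ≈ N n
  N-A n = perm-cong n (λ π _ → only-cong (avoids π) (trans (*-congˡ (gauss-zeroʳ _)) (*-identityʳ _)))

  A-1 : ∀ r → A 1 r ≈ 1#
  A-1 r = trans (perm-1 (λ π → only (avoids π) (wt π * gauss (1 ∸ suc (final π)) r))) (trans
    (only-true (avoids-short (0 ∷ []) (≡.subst (1 <_) (≡.sym p≡) (s≤s (s≤s z≤n)))))
    (trans (*-cong (*-identityˡ 1#) (gauss-zeroˡ r)) (*-identityˡ 1#)))

  private
    -- Appending a last value to an avoiding permutation, whether or not this completes a match.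
    append : ∀ i r → perm (suc (suc i)) (λ π → only (avoids (take (suc i) π))
                       (wt π * gauss (suc (suc i) ∸ suc (final π)) r)) ≈
             z * gauss (suc i) (suc r) * N (suc i) + y * A (suc i) (suc r)
    append i r = begin
      perm (suc n) F
        ≈⟨ reflexive (≡.cong (λ m → perm m F) (ℕₚ.+-comm 1 n)) ⟩
      perm (n ℕ.+ 1) F
        ≈⟨ perm-shuffle-swap n 1 F (λ w ρ → X ρ * Y (final ρ) w)
             (λ w ρ lw rw ρ↭ → trans (perm-1 (λ κ → F (map (posL w) ρ ++ map (posR w) κ))) (term w ρ lw rw ρ↭)) ⟩
      perm n (λ ρ → bits n 1 (λ w → X ρ * Y (final ρ) w))
        ≈⟨ perm-cong n (λ ρ ρ↭ → trans (bits-*ˡ n 1 (X ρ) (Y (final ρ)))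
             (trans (*-congˡ (bits-append n (final ρ) r (∈-perm⇒< ρ↭ (final-∈ (↭-upTo-length ρ↭)))))
             (expand ρ))) ⟩
      perm n (λ ρ → z * gauss n (suc r) * X ρ + y * W ρ)
        ≈⟨ trans (arr-+ n (upTo n) (λ ρ → z * gauss n (suc r) * X ρ) (λ ρ → y * W ρ))
             (+-cong (arr-*ˡ n (upTo n) (z * gauss n (suc r)) X) (arr-*ˡ n (upTo n) y W)) ⟩
      z * gauss n (suc r) * N n + y * A n (suc r) ∎
      where
      n : ℕ
      n = suc i
      F : List ℕ → Carrier
      F π = only (avoids (take n π)) (wt π * gauss (suc n ∸ suc (final π)) r)
      X : List ℕ → Carrier
      X ρ = only (avoids ρ) (wt ρ)
      W : List ℕ → Carrier
      W ρ = only (avoids ρ) (wt ρ * gauss (n ∸ suc (final ρ)) (suc r))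
      Y : ℕ → List Bool → Carrier
      Y b w = q ^ winv w * (z ^ bit (posR w 0 <ᵇ posL w b) * gauss (n ∸ posR w 0) r)
      expand : ∀ ρ → X ρ * (z * gauss n (suc r) + y * gauss (n ∸ suc (final ρ)) (suc r)) ≈
               z * gauss n (suc r) * X ρ + y * W ρ
      expand ρ = trans
        (solve 4 (λ x a y b → x :* (a :+ y :* b) := a :* x :+ y :* (x :* b)) refl _ _ _ _)
        (+-congˡ (*-congˡ (sym (only-*ʳ (avoids ρ) (wt ρ) _))))
      term : ∀ w ρ → lefts w ≡ n → rights w ≡ 1 → ρ ↭ upTo n →
             F (map (posL w) ρ ++ map (posR w) (0 ∷ [])) ≈ X ρ * Y (final ρ) w
      term w ρ lw rw ρ↭ = begin
        F shuffled
          ≈⟨ reflexive (weight-cong (suc n) r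
               (≡.trans (≡.cong avoids take-shuffled) (avoids-map (posL w) ρ (posL-mono w)))
               (≡.trans (inv-shuffled lw rw) (≡.cong (ℕ._+ winv w) (ℕₚ.+-identityʳ (inv ρ))))
               (≡.trans (des-shuffle w 0 [] ρ↭) (≡.cong (des ρ ℕ.+_) (ℕₚ.+-identityʳ _)))
               final-shuffled) ⟩
        only (avoids ρ) (q ^ (inv ρ ℕ.+ winv w) * z ^ (des ρ ℕ.+ bit (posR w 0 <ᵇ posL w (final ρ))) *
                         gauss (n ∸ posR w 0) r)
          ≈⟨ only-cong (avoids ρ) (trans
               (*-congʳ (*-cong (^-homo-* q (inv ρ) (winv w)) (^-homo-* z (des ρ) _)))
               (solve 5 (λ a b c d e → ((a :* b) :* (c :* d)) :* e := (a :* c) :* (b :* (d :* e))) refl _ _ _ _ _)) ⟩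
        only (avoids ρ) (wt ρ * Y (final ρ) w)
          ≈⟨ only-*ʳ (avoids ρ) (wt ρ) _ ⟩
        X ρ * Y (final ρ) w ∎
        where open Shuffle w {ρ} {0 ∷ []} ρ↭ ↭-refl

    -- Those permutations whose last p values form a match starting at position a.
    close : ∀ a r → perm (suc a ℕ.+ suc k) (λ π → only (does (match? π a)) (only (avoids (take (suc a) π))
                      (wt π * gauss ((suc a ℕ.+ suc k) ∸ suc (final π)) r))) ≈
            wt κ₀ * (gauss r (k ∸ c) * A (suc a) (suc (r ℕ.+ k)))
    close a r = begin
      perm (n ℕ.+ suc k) F
        ≈⟨ perm-shuffle-swap n (suc k) F (λ w ρ → X ρ * Y (final ρ) w) (λ w ρ lw rw ρ↭ → trans
             (perm-cong (suc k) (λ κ κ↭ → term w ρ κ lw ρ↭ κ↭)) (select w ρ lw rw ρ↭)) ⟩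
      perm n (λ ρ → bits n (suc k) (λ w → X ρ * Y (final ρ) w))
        ≈⟨ perm-cong n (λ ρ ρ↭ → trans (bits-*ˡ n (suc k) (X ρ) (Y (final ρ)))
             (trans (*-congˡ (bits-marked-above a k (final ρ) c r
               (ℕₚ.≤-pred (∈-perm⇒< ρ↭ (final-∈ (↭-upTo-length ρ↭)))) c≤k)) (expand ρ))) ⟩
      perm n (λ ρ → wt κ₀ * gauss r (k ∸ c) * W ρ)
        ≈⟨ trans (arr-*ˡ n (upTo n) (wt κ₀ * gauss r (k ∸ c)) W) (*-assoc _ _ _) ⟩
      wt κ₀ * (gauss r (k ∸ c) * A n (suc (r ℕ.+ k))) ∎
      where
      -- The left block has a + 1 values: its last one is also the first value of the match, so the
      -- right block carries only τ_2 ... τ_p.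
      n : ℕ
      n = suc a
      F : List ℕ → Carrier
      F π = only (does (match? π a)) (only (avoids (take n π)) (wt π * gauss ((n ℕ.+ suc k) ∸ suc (final π)) r))
      X : List ℕ → Carrier
      X ρ = wt κ₀ * only (avoids ρ) (wt ρ)
      W : List ℕ → Carrier
      W ρ = only (avoids ρ) (wt ρ * gauss (n ∸ suc (final ρ)) (suc (r ℕ.+ k)))
      Y : ℕ → List Bool → Carrier
      Y b w = only (posL w b <ᵇ posR w 0) (q ^ winv w * gauss ((n ℕ.+ suc k) ∸ suc (posR w c)) r)
      H : List Bool → List ℕ → List ℕ → Carrier
      H w ρ κ = only (posL w (final ρ) <ᵇ posR w 0) (only (avoids ρ)
        (wt (map (posL w) ρ ++ map (posR w) κ) * gauss ((n ℕ.+ suc k) ∸ suc (posR w (final κ))) r))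
      expand : ∀ ρ → X ρ * (gauss r (k ∸ c) * gauss (a ∸ final ρ) (suc (r ℕ.+ k))) ≈
               wt κ₀ * gauss r (k ∸ c) * W ρ
      expand ρ = trans
        (solve 4 (λ x a y b → (x :* a) :* (y :* b) := (x :* y) :* (a :* b)) refl _ _ _ _)
        (*-congˡ (sym (only-*ʳ (avoids ρ) (wt ρ) _)))
      term : ∀ w ρ κ → lefts w ≡ n → ρ ↭ upTo n → κ ↭ upTo (suc k) →
             F (map (posL w) ρ ++ map (posR w) κ) ≈ only (does (Listₚ.≡-dec _≟_ κ κ₀)) (H w ρ κ)
      term w ρ κ lw ρ↭ κ↭ = trans (reflexive (≡.cong₂ only match-test inner)) (and-only (posL w (final ρ) <ᵇ posR w 0) _)
        where
        open Shuffle w {ρ} {κ} ρ↭ κ↭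
        E : Carrier
        E = only (avoids ρ) (wt shuffled * gauss ((n ℕ.+ suc k) ∸ suc (posR w (final κ))) r)
        inner : only (avoids (take n shuffled)) (wt shuffled * gauss ((n ℕ.+ suc k) ∸ suc (final shuffled)) r) ≡ E
        inner = weight-cong (n ℕ.+ suc k) r
          (≡.trans (≡.cong avoids take-shuffled) (avoids-map (posL w) ρ (posL-mono w)))
          (≡.refl {x = inv shuffled}) (≡.refl {x = des shuffled}) final-shuffled
        and-only : ∀ b b′ → only (b ∧ b′) E ≈ only b′ (only b E)
        and-only true  true  = refl
        and-only true  false = refl
        and-only false true  = refl
        and-only false false = refl
        window : take p (drop a shuffled) ≡ posL w (final ρ) ∷ map (posR w) κ
        window = ≡.trans (≡.cong (take p) drop-shuffled)
          (Listₚ.take-all p _ (ℕₚ.≤-reflexive (≡.trans (≡.cong suc lengthʳ) (≡.sym p≡))))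
        match-test : does (match? shuffled a) ≡ (posL w (final ρ) <ᵇ posR w 0) ∧ does (Listₚ.≡-dec _≟_ κ κ₀)
        match-test = ≡.trans (≡.cong (λ v → does (Listₚ.≡-dec _≟_ (red v) τ)) window)
          (red-shuffle w κ₀ (≡.subst (final ρ <_) (≡.sym lw) (∈-perm⇒< ρ↭ (final-∈ (↭-upTo-length ρ↭)))) κ↭)
      H-κ₀ : ∀ w ρ → lefts w ≡ n → rights w ≡ suc k → ρ ↭ upTo n → H w ρ κ₀ ≈ X ρ * Y (final ρ) w
      H-κ₀ w ρ lw rw ρ↭ with posL w (final ρ) <? posR w 0
      ... | no  l≮ rewrite dec-false (posL w (final ρ) <? posR w 0) l≮ = sym (zeroʳ _)
      ... | yes l  rewrite dec-true (posL w (final ρ) <? posR w 0) l = begin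
        only (avoids ρ) (wt shuffled * g)
          ≈⟨ only-cong (avoids ρ) (*-congʳ (*-cong
               (reflexive (≡.cong (q ^_) (inv-shuffled lw rw)))
               (reflexive (≡.cong (z ^_) (des-shuffle-above w ρ↭ κ₀-perm l))))) ⟩
        only (avoids ρ) (q ^ (inv ρ ℕ.+ inv κ₀ ℕ.+ winv w) * z ^ (des ρ ℕ.+ des κ₀) * g)
          ≈⟨ only-cong (avoids ρ) (trans
               (*-congʳ (*-cong (trans (^-homo-* q (inv ρ ℕ.+ inv κ₀) (winv w)) (*-congʳ (^-homo-* q (inv ρ) (inv κ₀))))
                                (^-homo-* z (des ρ) (des κ₀))))
               (solve 6 (λ a a′ b d d′ e → (((a :* a′) :* b) :* (d :* d′)) :* e := (a :* d) :* ((a′ :* d′) :* (b :* e)))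
                  refl _ _ _ _ _ _)) ⟩
        only (avoids ρ) (wt ρ * (wt κ₀ * (q ^ winv w * g)))
          ≈⟨ only-*ʳ (avoids ρ) (wt ρ) _ ⟩
        only (avoids ρ) (wt ρ) * (wt κ₀ * (q ^ winv w * g))
          ≈⟨ solve 3 (λ a b c → a :* (b :* c) := (b :* a) :* c) refl _ _ _ ⟩
        X ρ * (q ^ winv w * g) ∎
        where
        open Shuffle w {ρ} {κ₀} ρ↭ κ₀-perm
        g : Carrier
        g = gauss ((n ℕ.+ suc k) ∸ suc (posR w c)) r
      select : ∀ w ρ → lefts w ≡ n → rights w ≡ suc k → ρ ↭ upTo n →
               perm (suc k) (λ κ → only (does (Listₚ.≡-dec _≟_ κ κ₀)) (H w ρ κ)) ≈ X ρ * Y (final ρ) w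
      select w ρ lw rw ρ↭ = trans
        (reflexive (≡.cong (λ m → arr m (upTo (suc k)) (λ κ → only (does (Listₚ.≡-dec _≟_ κ κ₀)) (H w ρ κ)))
          (≡.sym κ₀-length)))
        (trans (arr-δ κ₀ (H w ρ) (Uniqueₚ.upTo⁺ (suc k)) κ₀-perm) (H-κ₀ w ρ lw rw ρ↭))

    -- If all values but the last avoid τ, the only possible match is the last window, at a. When
    -- that window matches, `noMatch-before-match` makes avoidance on the first a + 1 values
    -- equivalent to avoidance on all but the last, which turns the condition into the one that
    -- `close` evaluates.
    only-split : ∀ a π X → length π ≡ suc (a ℕ.+ suc k) → Unique π →
      only (avoids π) X + only (does (match? π a)) (only (avoids (take (suc a) π)) X) ≈
      only (avoids (take (a ℕ.+ suc k) π)) X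
    only-split a π X len u = go (numMatches τ (take m π) ≟ 0) (match? π a)
      where
      m : ℕ
      m = a ℕ.+ suc k
      before : Match π a → numMatches τ (take (suc a) π) ≡ 0 → numMatches τ (take m π) ≡ 0
      before ma e = ≡.subst (λ j → numMatches τ (take (a ℕ.+ j) π) ≡ 0) (≡.cong (_∸ 1) p≡)
        (noMatch-before-match tight π a u ma e)
      goal : Set
      goal = only (avoids π) X + only (does (match? π a)) (only (avoids (take (suc a) π)) X) ≈
             only (avoids (take m π)) X
      go : Dec (numMatches τ (take m π) ≡ 0) → Dec (Match π a) → goal
      go (no some) d = trans (+-cong (only-false (dec-false (numMatches τ π ≟ 0)
          (λ none → some (noMatch-take⇐ m π (λ j _ → noMatch⇒ π none j))))) (end d))
        (trans (+-identityˡ 0#) (sym (only-false (dec-false (numMatches τ (take m π) ≟ 0) some))))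
        where
        end : Dec (Match π a) → only (does (match? π a)) (only (avoids (take (suc a) π)) X) ≈ 0#
        end (yes ma) = trans (only-true (dec-true (match? π a) ma))
          (only-false (dec-false (numMatches τ (take (suc a) π) ≟ 0) (λ e → some (before ma e))))
        end (no ¬ma) = only-false (dec-false (match? π a) ¬ma)
      go (yes none) (yes ma) = trans (+-cong
          (only-false (dec-false (numMatches τ π ≟ 0) (λ e → noMatch⇒ π e a ma)))
          (trans (only-true (dec-true (match? π a) ma))
            (only-true (dec-true (numMatches τ (take (suc a) π) ≟ 0) (noMatch-take⇐ (suc a) π λ j l →
              noMatch-take⇒ m π none j (ℕₚ.≤-trans l (ℕₚ.m<m+n a (s≤s z≤n))))))))
        (trans (+-identityˡ X) (sym (only-true (dec-true (numMatches τ (take m π) ≟ 0) none))))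
      go (yes none) (no ¬ma) = trans (+-cong
          (only-true (dec-true (numMatches τ π ≟ 0) (noMatch⇐ π nowhere)))
          (only-false (dec-false (match? π a) ¬ma)))
        (trans (+-identityʳ X) (sym (only-true (dec-true (numMatches τ (take m π) ≟ 0) none))))
        where
        nowhere : ∀ j → ¬ Match π j
        nowhere j mj with j ≟ a
        ... | yes ≡.refl = ¬ma mj
        ... | no  j≢a    = noMatch-take⇒ m π none j fits mj
          where
          ends : ∀ j → j ℕ.+ p ≡ suc j ℕ.+ suc k
          ends j = ≡.trans (≡.cong (j ℕ.+_) p≡) (ℕₚ.+-suc j (suc k))
          j≤a : j ≤ a
          j≤a = ℕₚ.≤-pred (ℕₚ.+-cancelʳ-≤ (suc k) (suc j) (suc a)
                  (≡.subst₂ _≤_ (ends j) len (match-fits π j mj)))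
          fits : j ℕ.+ p ≤ m
          fits = ≡.subst (_≤ m) (≡.sym (ends j)) (ℕₚ.+-monoˡ-≤ (suc k) (ℕₚ.≤∧≢⇒< j≤a j≢a))

    A-restrict : ∀ a r m → m ≡ a ℕ.+ suc k →
      A (suc m) r + wt κ₀ * (gauss r (k ∸ c) * A (suc a) (suc (r ℕ.+ k))) ≈
      perm (suc m) (λ π → only (avoids (take m π)) (wt π * gauss (suc m ∸ suc (final π)) r))
    A-restrict a r m ≡.refl = trans (+-congˡ (sym (close a r)))
      (trans (sym (arr-+ (suc m) (upTo (suc m)) (λ π → only (avoids π) (X π))
                     (λ π → only (does (match? π a)) (only (avoids (take (suc a) π)) (X π)))))
             (perm-cong (suc m) (λ π π↭ → only-split a π (X π) (↭-upTo-length π↭) (perm-Unique π↭))))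
      where
      X : List ℕ → Carrier
      X π = wt π * gauss (suc m ∸ suc (final π)) r

  A-long : ∀ a r →
    A (suc (suc (a ℕ.+ k))) r + wt κ₀ * (gauss r (k ∸ c) * A (suc a) (suc (r ℕ.+ k))) ≈
    z * gauss (suc (a ℕ.+ k)) (suc r) * N (suc (a ℕ.+ k)) + y * A (suc (a ℕ.+ k)) (suc r)
  A-long a r = trans (A-restrict a r (suc (a ℕ.+ k)) (≡.sym (ℕₚ.+-suc a k))) (append (a ℕ.+ k) r)

  -- A permutation of i + 2 < p values is too short for a match, so avoidance is no restriction
  -- before or after appending.
  A-short : ∀ i r → i < k →
    A (suc (suc i)) r ≈ z * gauss (suc i) (suc r) * N (suc i) + y * A (suc i) (suc r)
  A-short i r i<k = trans (perm-cong (suc (suc i)) (λ π π↭ → reflexive (≡.cong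
      (λ b → only b (wt π * gauss (suc (suc i) ∸ suc (final π)) r)) (≡.trans
        (avoids-short π (≡.subst₂ _<_ (≡.sym (↭-upTo-length π↭)) (≡.sym p≡) (s≤s (s≤s i<k))))
        (≡.sym (avoids-short (take (suc i) π) (ℕₚ.≤-<-trans
          (ℕₚ.≤-trans (ℕₚ.≤-reflexive (Listₚ.length-take (suc i) π)) (ℕₚ.m⊓n≤m (suc i) (length π)))
          (≡.subst (suc i <_) (≡.sym p≡) (s≤s (ℕₚ.m<n⇒m<1+n i<k))))))))))
    (append i r)

  -- f (n ∸ k), read as 0 when n < k
  delay : ℕ → (ℕ → Carrier) → ℕ → Carrier
  delay zero    f n       = f n
  delay (suc k) f zero    = 0#
  delay (suc k) f (suc n) = delay k f n

  delay-short : ∀ {k n} f → n < k → delay k f n ≈ 0#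
  delay-short {suc k} {zero}  f l       = refl
  delay-short {suc k} {suc n} f (s≤s l) = delay-short f l

  delay-long : ∀ k n f → delay k f (n ℕ.+ k) ≡ f n
  delay-long zero    n f = ≡.cong f (ℕₚ.+-identityʳ n)
  delay-long (suc k) n f rewrite ℕₚ.+-suc n k = delay-long k n f

  -- The delayed argument is m = n - k, so a factor taken at m + k is a factor at n and can be
  -- pulled out.
  delay-*ʳ : ∀ k n f (g : ℕ → Carrier) → delay k (λ m → f m * g (m ℕ.+ k)) n ≈ delay k f n * g n
  delay-*ʳ zero    n       f g = *-congˡ (reflexive (≡.cong g (ℕₚ.+-identityʳ n)))
  delay-*ʳ (suc k) zero    f g = sym (zeroˡ _)
  delay-*ʳ (suc k) (suc n) f g = trans (reflexive (delay-cong k n λ m → ≡.cong (λ i → f m * g i) (ℕₚ.+-suc m k)))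
                                       (delay-*ʳ k n f (g ∘ suc))
    where
    delay-cong : ∀ k n {f g : ℕ → Carrier} → (∀ m → f m ≡ g m) → delay k f n ≡ delay k g n
    delay-cong zero    n       e = e n
    delay-cong (suc k) zero    e = ≡.refl
    delay-cong (suc k) (suc n) e = delay-cong k n e

  -- Delaying either index leaves the sum of X over i + j = n - k.
  diag-delay : ∀ k n (X : ℕ → ℕ → Carrier) →
    diag n (λ i j → delay k (λ m → X m j) i) ≈ diag n (λ i j → delay k (X i) j)
  diag-delay zero    n       X = refl
  diag-delay (suc k) zero    X = refl
  diag-delay (suc k) (suc n) X = trans (+-identityˡ _) (trans (diag-delay k n X)
    (sym (trans (diag-last n (λ i j → delay (suc k) (X i) j)) (+-identityʳ _))))

  diag-head : ∀ n f g → diag n f ≈ diag n g →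
    (∀ i j → suc i ℕ.+ j ≡ n → f (suc i) j ≈ g (suc i) j) → f 0 n ≈ g 0 n
  diag-head zero    f g e h = e
  diag-head (suc n) f g e h = cancel (f 0 (suc n)) (g 0 (suc n)) _
    (trans e (+-congˡ (sym (diag-cong n (λ i j p → h i j (≡.cong suc p))))))
    where
    cancel : ∀ a b c → a + c ≈ b + c → a ≈ b
    cancel a b c e = begin
      a              ≈⟨ sym (+-identityʳ a) ⟩
      a + 0#         ≈⟨ +-congˡ (sym (-‿inverseʳ c)) ⟩
      a + (c + - c)  ≈⟨ sym (+-assoc a c (- c)) ⟩
      (a + c) + - c  ≈⟨ +-congʳ e ⟩
      (b + c) + - c  ≈⟨ +-assoc b c (- c) ⟩
      b + (c + - c)  ≈⟨ +-congˡ (-‿inverseʳ c) ⟩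
      b + 0#         ≈⟨ +-identityʳ b ⟩
      b              ∎

  A-recurrence : ∀ a r →
    A (suc (suc a)) r + delay k (λ a′ → wt κ₀ * (gauss r (k ∸ c) * A (suc a′) (suc (r ℕ.+ k)))) a ≈
    z * gauss (suc a) (suc r) * N (suc a) + y * A (suc a) (suc r)
  A-recurrence a r with k ≤? a
  ... | no  k≰a = trans (+-congˡ (delay-short _ (ℕₚ.≰⇒> k≰a))) (trans (+-identityʳ _) (A-short a r (ℕₚ.≰⇒> k≰a)))
  ... | yes k≤a = ≡.subst
    (λ a → A (suc (suc a)) r + delay k f a ≈ z * gauss (suc a) (suc r) * N (suc a) + y * A (suc a) (suc r))
    (ℕₚ.m∸n+n≡m k≤a)
    (trans (+-congˡ (reflexive (delay-long k (a ∸ k) f))) (A-long (a ∸ k) r))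
    where
    f : ℕ → Carrier
    f a′ = wt κ₀ * (gauss r (k ∸ c) * A (suc a′) (suc (r ℕ.+ k)))

  coeff : ℕ → Carrier
  coeff zero    = 1#
  coeff (suc n) = z * N (suc n)

  -- Lowering all values by 1 changes neither `inv`, `des` nor avoidance, which allows zero-based
  -- permutations. The factor z accounts for the exponent des + 1.
  listΣ-avoiding : ∀ n → listΣ (filter (λ σ → numMatches τ σ ≟ 0) (perms n)) (λ σ → z * wt σ) ≈ z * N n
  listΣ-avoiding n = begin
    listΣ (filter (λ σ → numMatches τ σ ≟ 0) (perms n)) f
      ≈⟨ trans (listΣ-filter (λ σ → numMatches τ σ ≟ 0) (perms n) f) (listΣ-filter unique? (seqs n n) g) ⟩
    listΣ (seqs n n) (λ σ → only (does (unique? σ)) (g σ))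
      ≈⟨ reflexive (≡.cong (λ L → listΣ L (λ σ → only (does (unique? σ)) (g σ))) (seqs≡seqsFrom n n)) ⟩
    listΣ (seqsFrom (map suc (upTo n)) n) (λ σ → only (does (unique? σ)) (g σ))
      ≈⟨ arr-unique n g (Uniqueₚ.map⁺ ℕₚ.suc-injective (Uniqueₚ.upTo⁺ n)) ⟩
    arr n (map suc (upTo n)) g
      ≈⟨ arr-map n suc (upTo n) g ⟩
    perm n (λ σ → g (map suc σ))
      ≈⟨ perm-cong n (λ σ _ → trans (reflexive (shifted σ)) (factor (avoids σ) (wt σ))) ⟩
    perm n (λ σ → z * only (avoids σ) (wt σ))
      ≈⟨ arr-*ˡ n (upTo n) z (λ σ → only (avoids σ) (wt σ)) ⟩
    z * N n ∎
    where
    f g : List ℕ → Carrier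
    f σ = z * wt σ
    g σ = only (avoids σ) (f σ)
    factor : ∀ b x → only b (z * x) ≈ z * only b x
    factor true  x = refl
    factor false x = sym (zeroʳ z)
    shifted : ∀ σ → g (map suc σ) ≡ g σ
    shifted σ = only-wt (avoids-map suc σ s≤s) (inv-map suc σ (monotone⇒preserves σ s≤s))
                        (des-map suc σ (monotone⇒preserves σ s≤s))
      where
      only-wt : ∀ {b b′ i i′ d d′} → b ≡ b′ → i ≡ i′ → d ≡ d′ →
                only b (z * (q ^ i * z ^ d)) ≡ only b′ (z * (q ^ i′ * z ^ d′))
      only-wt ≡.refl ≡.refl ≡.refl = ≡.refl

  module Reciprocal (U : ℕ → Carrier) (U-zero : U 0 ≈ 1#)
    (U-reciprocal : ∀ n → diag (suc n) (λ i j → gauss i j * coeff i * U j) ≈ 0#) where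

    U-one : U 1 + z ≈ 0#
    U-one = trans (+-cong (sym first) (sym second)) (U-reciprocal 0)
      where
      first : gauss 0 1 * 1# * U 1 ≈ U 1
      first = trans (*-congʳ (trans (*-identityʳ _) (gauss-zeroˡ 1))) (*-identityˡ _)
      second : gauss 1 0 * (z * N 1) * U 0 ≈ z
      second = trans (*-cong (*-cong (gauss-zeroʳ 1) (trans (*-congˡ (trans (sym (N-A 1)) (A-1 0))) (*-identityʳ z))) U-zero)
                     (trans (*-identityʳ _) (*-identityˡ _))

    -- The subtracted term of the recurrence at n = u + p: there [n-s choose p-s] is
    -- `gauss u (k ∸ c)`, and n - p + 1 is u + 1.
    step : ℕ → Carrier
    step u = wt κ₀ * (gauss u (k ∸ c) * U (suc u))

    private
      X : ℕ → ℕ → Carrier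
      X a u = step u * A (suc a) (suc (u ℕ.+ k))

      shifted : ℕ → ℕ → Carrier
      shifted a r = U (suc (suc r)) * A (suc a) (suc r)

      grown : ℕ → ℕ → Carrier
      grown a r = U (suc r) * (y * A (suc a) (suc r))

      -- Summing U_{r+1} times the recurrence of A along a + r = m, everything but these terms telescopes.
      balance : ∀ m → diag m grown ≈ diag m (λ a r → shifted a r + delay k (X a) r)
      balance m = sym (begin
        diag m (λ a r → shifted a r + delay k (X a) r)
          ≈⟨ trans (diag-+ m shifted (λ a r → delay k (X a) r)) (+-congˡ (sym (diag-delay k m X))) ⟩
        S + D
          ≈⟨ sym (+-identityʳ _) ⟩
        S + D + 0#
          -- A zero, by U_1 = -z, that supplies the missing end of the diagonal sum.
          ≈⟨ +-congˡ (sym final-term) ⟩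
        S + D + (U 1 * A (suc (suc m)) 0 + z * N (suc (suc m)))
          ≈⟨ solve 4 (λ s d a b → s :+ d :+ (a :+ b) := (s :+ a) :+ (d :+ b)) refl _ _ _ _ ⟩
        (S + U 1 * A (suc (suc m)) 0) + (D + z * N (suc (suc m)))
          -- The sum of U_{r+1} A_{a+1,r} over a + r = m + 1 is read from both ends: S omits a = m +
          -- 1, S′ omits a = 0, whose term is U_{m+2}.
          ≈⟨ +-congʳ (trans (sym (diag-last m (λ a r → U (suc r) * A (suc a) r)))
                            (+-congʳ (trans (*-congˡ (A-1 (suc m))) (*-identityʳ _)))) ⟩
        (U (suc (suc m)) + S′) + (D + z * N (suc (suc m)))
          ≈⟨ solve 4 (λ u s d b → (u :+ s) :+ (d :+ b) := (s :+ d) :+ (u :+ b)) refl _ _ _ _ ⟩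
        (S′ + D) + (U (suc (suc m)) + z * N (suc (suc m)))
          ≈⟨ +-congʳ recurrence ⟩
        (B + diag m grown) + (U (suc (suc m)) + z * N (suc (suc m)))
          ≈⟨ solve 4 (λ b g u n → (b :+ g) :+ (u :+ n) := g :+ (u :+ (b :+ n))) refl _ _ _ _ ⟩
        diag m grown + (U (suc (suc m)) + (B + z * N (suc (suc m))))
          ≈⟨ trans (+-congˡ vanishing) (+-identityʳ _) ⟩
        diag m grown ∎)
        where
        S S′ D B : Carrier
        S  = diag m shifted
        S′ = diag m (λ a r → U (suc r) * A (suc (suc a)) r)
        D  = diag m (λ a r → delay k (λ a′ → X a′ r) a)
        B  = diag m (λ a r → gauss (suc a) (suc r) * (z * N (suc a)) * U (suc r))
        final-term : U 1 * A (suc (suc m)) 0 + z * N (suc (suc m)) ≈ 0#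
        final-term = trans (+-congʳ (*-congˡ (N-A (suc (suc m))))) (trans (sym (distribʳ _ _ _))
          (trans (*-congʳ U-one) (zeroˡ _)))
        -- The reciprocal relation at m + 2, with its first and last terms split off from the inner
        -- sum B.
        vanishing : U (suc (suc m)) + (B + z * N (suc (suc m))) ≈ 0#
        vanishing = trans (+-cong
            (sym (trans (*-congʳ (trans (*-identityʳ _) (gauss-zeroˡ (suc (suc m))))) (*-identityˡ _)))
            (trans (+-congˡ (sym (trans (*-cong (trans (*-congʳ (gauss-zeroʳ (suc (suc m)))) (*-identityˡ _)) U-zero) (*-identityʳ _))))
                   (sym (diag-last m (λ i j → gauss (suc i) j * coeff (suc i) * U j)))))
          (U-reciprocal (suc m))
        recurrence : S′ + D ≈ B + diag m grown
        recurrence = trans (sym (diag-+ m _ _)) (trans (diag-cong′ m each) (diag-+ m _ _))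
          where
          each : ∀ a r → U (suc r) * A (suc (suc a)) r + delay k (λ a′ → X a′ r) a ≈
                 gauss (suc a) (suc r) * (z * N (suc a)) * U (suc r) + grown a r
          each a r = begin
            U (suc r) * A (suc (suc a)) r + delay k (λ a′ → X a′ r) a
              ≈⟨ +-congˡ (trans (delay-cong k a (λ a′ →
                   solve 4 (λ w g u x → (w :* (g :* u)) :* x := (w :* (g :* x)) :* u) refl _ _ _ _))
                   (delay-*ʳ k a f (λ _ → U (suc r)))) ⟩
            U (suc r) * A (suc (suc a)) r + delay k f a * U (suc r)
              ≈⟨ solve 3 (λ u a d → u :* a :+ d :* u := u :* (a :+ d)) refl _ _ _ ⟩
            U (suc r) * (A (suc (suc a)) r + delay k f a)
              ≈⟨ *-congˡ (A-recurrence a r) ⟩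
            U (suc r) * (z * gauss (suc a) (suc r) * N (suc a) + y * A (suc a) (suc r))
              ≈⟨ solve 5 (λ u z g n x → u :* (z :* g :* n :+ x) := g :* (z :* n) :* u :+ u :* x) refl _ _ _ _ _ ⟩
            gauss (suc a) (suc r) * (z * N (suc a)) * U (suc r) + grown a r ∎
            where
            f : ℕ → Carrier
            f a′ = wt κ₀ * (gauss r (k ∸ c) * A (suc a′) (suc (r ℕ.+ k)))
            delay-cong : ∀ k n {f g : ℕ → Carrier} → (∀ m → f m ≈ g m) → delay k f n ≈ delay k g n
            delay-cong zero    n       e = e n
            delay-cong (suc k) zero    e = refl
            delay-cong (suc k) (suc n) e = delay-cong k n e

    -- In `balance` the terms with a > 0 agree by the induction hypothesis at r < m, multiplied by
    -- A_{a+1,r+1}. Cancelling them leaves a = 0, where A_{1,m+1} = 1.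
    U-recurrence : ∀ m → y * U (suc m) ≈ U (suc (suc m)) + delay k step m
    U-recurrence = <-rec _ λ m rec → begin
      y * U (suc m)
        ≈⟨ sym (trans (*-congˡ (trans (*-congˡ (A-1 (suc m))) (*-identityʳ y))) (*-comm _ _)) ⟩
      grown 0 m
        ≈⟨ diag-head m grown (λ a r → shifted a r + delay k (X a) r) (balance m) (λ a r e →
             trans (solve 3 (λ u y x → u :* (y :* x) := (y :* u) :* x) refl _ _ _)
             (trans (*-congʳ (rec (≡.subst (r <_) e (s≤s (ℕₚ.m≤n+m r a)))))
             (trans (distribʳ _ _ _) (+-congˡ (sym (delay-*ʳ k r step (λ n → A (suc (suc a)) (suc n)))))))) ⟩
      U (suc (suc m)) * A 1 (suc m) + delay k (X 0) m
        ≈⟨ +-cong (trans (*-congˡ (A-1 (suc m))) (*-identityʳ _))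
             (trans (delay-*ʳ k m step (λ n → A 1 (suc n))) (trans (*-congˡ (A-1 (suc m))) (*-identityʳ _))) ⟩
      U (suc (suc m)) + delay k step m ∎

-- Specialisation to series in q and z

module ℤDiag = DiagonalSums ℤₚ.+-*-commutativeRing
module QPS = PowerSeries ℤₚ.+-*-commutativeRing
module QZDiag = DiagonalSums QPS.powerSeries
module QZPS = PowerSeries QPS.powerSeries

-- Series in q over series in z. The carrier unfolds to `Ser` and its equality to `≈S`, so results
-- over an abstract ring apply to the given series directly; only the form of the product differs.
seriesRing : CommutativeRing 0ℓ 0ℓ
seriesRing = QZPS.powerSeries

module SDiag = DiagonalSums seriesRing
module S = CommutativeRing seriesRing
open Exp S.semiring using (_^_)
open import Relation.Binary.Reasoning.Setoid S.setoid

sumTo-partial : ∀ n f → sumTo n f ≡ ℤDiag.partial n f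
sumTo-partial zero    f = ≡.refl
sumTo-partial (suc n) f = ≡.cong (ℤ._+ f (suc n)) (sumTo-partial n f)

sumTo-diag : ∀ n h → sumTo n (λ i → h i (n ∸ i)) ≡ ℤDiag.diag n h
sumTo-diag n h = ≡.trans (sumTo-partial n _) (ℤDiag.partial-diag n h)

diag-at : ∀ n h j → QZDiag.diag n h j ≡ ℤDiag.diag n (λ a b → h a b j)
diag-at zero    h j = ≡.refl
diag-at (suc n) h j = ≡.cong (ℤ._+_ (h 0 (suc n) j)) (diag-at n (λ a b → h (suc a) b) j)

*S≈* : ∀ f g → f *S g ≈S f S.* g
*S≈* f g i j = ≡.trans
  (sumTo-diag i (λ a b → sumTo j (λ c → f a c ℤ.* g b (j ∸ c))))
  (≡.trans (ℤDiag.diag-cong′ i (λ a b → sumTo-diag j (λ c d → f a c ℤ.* g b d)))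
           (≡.sym (diag-at i (λ a b k → ℤDiag.diag k (λ c d → f a c ℤ.* g b d)) j)))

sumS-partial : ∀ n f → sumS n f ≈S SDiag.partial n f
sumS-partial zero    f i j = ≡.refl
sumS-partial (suc n) f i j = ≡.cong (ℤ._+ f (suc n) i j) (sumS-partial n f i j)

q z : Ser
q = QZPS.X
z = QZPS.constant QPS.X

embQ-constant : ∀ f i j → embQ f i j ≡ QPS.constant (f i) j
embQ-constant f i zero    = ≡.refl
embQ-constant f i (suc j) = ≡.refl

embQ-cong : ∀ {f g : QSer} → (∀ i → f i ≡ g i) → embQ f ≈S embQ g
embQ-cong e i zero    = e i
embQ-cong e i (suc j) = ≡.refl

embQ-* : ∀ f g → embQ (f *Q g) ≈S embQ f S.* embQ g
embQ-* f g i j = ≡.trans (at j) (≡.sym (diag-at i (λ a b k → ℤDiag.diag k (λ c d → embQ f a c ℤ.* embQ g b d)) j))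
  where
  term : ∀ a b j → ℤDiag.diag j (λ c d → embQ f a c ℤ.* embQ g b d) ≡ f a ℤ.* embQ g b j
  term a b j = ≡.trans (ℤDiag.diag-cong′ j (λ c d → ≡.cong (ℤ._* embQ g b d) (embQ-constant f a c)))
                       (QPS.constant⊗ (f a) (embQ g b) j)
  at : ∀ j → embQ (f *Q g) i j ≡ ℤDiag.diag i (λ a b → ℤDiag.diag j (λ c d → embQ f a c ℤ.* embQ g b d))
  at zero    = ≡.trans (sumTo-diag i (λ a b → f a ℤ.* g b)) (≡.sym (ℤDiag.diag-cong′ i (λ a b → term a b 0)))
  at (suc j) = ≡.sym (ℤDiag.diag-0 i (λ a b _ → ≡.trans (term a b (suc j)) (ℤₚ.*-zeroʳ (f a))))

embQ-one : embQ oneQ ≈S S.1#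
embQ-one zero    zero    = ≡.refl
embQ-one zero    (suc j) = ≡.refl
embQ-one (suc i) zero    = ≡.refl
embQ-one (suc i) (suc j) = ≡.refl

open QFactorials seriesRing q using (qnum; fact)

embQ-qint : ∀ n → embQ (qint n) ≈S qnum n
embQ-qint zero    i       zero    = ≡.refl
embQ-qint zero    i       (suc j) = ≡.refl
embQ-qint (suc n) zero    j       = ≡.sym (≡.trans (≡.cong (ℤ._+_ (S.1# 0 j)) (QZPS.X⊗-zero (qnum n) j))
  (≡.trans (ℤₚ.+-identityʳ _) (≡.sym (initial j))))
  where
  initial : ∀ j → embQ (qint (suc n)) 0 j ≡ S.1# 0 j
  initial zero    = ≡.refl
  initial (suc j) = ≡.refl
embQ-qint (suc n) (suc i) j       = ≡.sym (≡.trans (ℤₚ.+-identityˡ _)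
  (≡.trans (QZPS.X⊗-suc (qnum n) i j) (≡.trans (≡.sym (embQ-qint n i j)) (later j))))
  where
  later : ∀ j → embQ (qint n) i j ≡ embQ (qint (suc n)) (suc i) j
  later zero    = ≡.refl
  later (suc j) = ≡.refl

embQ-qfact : ∀ n → embQ (qfact n) ≈S fact n
embQ-qfact zero    = embQ-one
embQ-qfact (suc n) = begin
  embQ (qfact n *Q qint (suc n))              ≈⟨ embQ-* (qfact n) (qint (suc n)) ⟩
  embQ (qfact n) S.* embQ (qint (suc n))      ≈⟨ S.*-cong {embQ (qfact n)} {fact n} {embQ (qint (suc n))} {qnum (suc n)}
                                                   (embQ-qfact n) (embQ-qint (suc n)) ⟩
  fact n S.* qnum (suc n)                     ∎

-- `invList f n` runs from the n-th coefficient down to the constant one, so pairing it with f from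
-- index s onwards is a Cauchy sum.
invStep-diag : ∀ f n s → invStep f s (invList f n) ≡ ℤDiag.diag n (λ i j → f (i ℕ.+ s) ℤ.* invQ f j)
invStep-diag f zero    s = ℤₚ.+-identityʳ _
invStep-diag f (suc n) s = ≡.cong (ℤ._+_ (f s ℤ.* invQ f (suc n))) (≡.trans (invStep-diag f n (suc s))
  (ℤDiag.diag-cong′ n (λ i j → ≡.cong (λ m → f m ℤ.* invQ f j) (ℕₚ.+-suc i s))))

-- Each new coefficient is minus the rest of the convolution, and cancels it because f has constant
-- term 1.
invQ-inverse : ∀ f → f 0 ≡ + 1 → ∀ n → (f *Q invQ f) n ≡ oneQ n
invQ-inverse f f0 n = ≡.trans (sumTo-diag n (λ i j → f i ℤ.* invQ f j)) (at n)
  where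
  at : ∀ n → ℤDiag.diag n (λ i j → f i ℤ.* invQ f j) ≡ oneQ n
  at zero    = ≡.trans (ℤₚ.*-identityʳ _) f0
  at (suc n) = ≡.trans (≡.cong₂ ℤ._+_ (≡.trans (≡.cong (ℤ._* invQ f (suc n)) f0) (ℤₚ.*-identityˡ _))
      (≡.trans (ℤDiag.diag-cong′ n (λ i j → ≡.cong (λ m → f m ℤ.* invQ f j) (ℕₚ.+-comm 1 i)))
               (≡.sym (invStep-diag f n 1))))
    (ℤₚ.+-inverseˡ (invStep f 1 (invList f n)))

qfact-zero : ∀ n → qfact n 0 ≡ + 1
qfact-zero zero    = ≡.refl
qfact-zero (suc n) = ≡.trans (ℤₚ.*-identityʳ _) (qfact-zero n)

fact⁻¹ : ℕ → Ser
fact⁻¹ n = embQ (invQ (qfact n))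

embQ-inverse : ∀ f → f 0 ≡ + 1 → embQ f S.* embQ (invQ f) ≈S S.1#
embQ-inverse f f0 = begin
  embQ f S.* embQ (invQ f)    ≈⟨ embQ-* f (invQ f) ⟨
  embQ (f *Q invQ f)          ≈⟨ embQ-cong (invQ-inverse f f0) ⟩
  embQ oneQ                   ≈⟨ embQ-one ⟩
  S.1#                        ∎

fact-inverse : ∀ n → fact n S.* fact⁻¹ n ≈S S.1#
fact-inverse n = begin
  fact n S.* fact⁻¹ n            ≈⟨ S.*-congʳ {fact⁻¹ n} {embQ (qfact n)} {fact n} (embQ-qfact n) ⟨
  embQ (qfact n) S.* fact⁻¹ n    ≈⟨ embQ-inverse (qfact n) (qfact-zero n) ⟩
  S.1#                           ∎

module Inverses (R : CommutativeRing 0ℓ 0ℓ) where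
  open CommutativeRing R
  open NatSolver commutativeSemiring using (solve; _:=_; _:+_; _:*_)

  -- Uniqueness of inverses, needed because `qbinom` inverts a product of q-factorials while `gauss`
  -- multiplies their inverses.
  product-inverse : ∀ {a a′ b b′ c} → a * a′ ≈ 1# → b * b′ ≈ 1# → a * b * c ≈ 1# → c ≈ a′ * b′
  product-inverse {a} {a′} {b} {b′} {c} e e′ e″ =
    trans (sym (trans (*-congʳ (trans (*-cong e e′) (*-identityˡ 1#))) (*-identityˡ c)))
      (trans (solve 5 (λ a a′ b b′ c → (a :* a′) :* (b :* b′) :* c := (a′ :* b′) :* (a :* b :* c)) refl _ _ _ _ _)
             (trans (*-congˡ e″) (*-identityʳ _)))

  zero-summand : ∀ {x a d} → x ≈ a + d → d ≈ 0# → a ≈ x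
  zero-summand e d≈0 = sym (trans e (trans (+-congˡ d≈0) (+-identityʳ _)))

  move-summand : ∀ {x a d} → x ≈ a + d → a ≈ x + - d
  move-summand {x} {a} {d} e = sym (trans (+-congʳ e) (trans (+-assoc a d (- d))
    (trans (+-congˡ (-‿inverseʳ d)) (+-identityʳ a))))

  complement : ∀ x → x + (1# + - x) ≈ 1#
  complement x = trans (+-comm x _) (trans (+-assoc 1# (- x) x) (trans (+-congˡ (-‿inverseˡ x)) (+-identityʳ 1#)))

open Inverses seriesRing
open Gauss seriesRing q fact⁻¹ fact-inverse using (gauss; gauss-comm)

qbinom-gauss : ∀ i j → embQ (qbinom (i ℕ.+ j) i) ≈S gauss i j
qbinom-gauss i j = begin
  embQ (qbinom (i ℕ.+ j) i)                ≡⟨ ≡.cong embQ unfold ⟩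
  embQ (qfact (i ℕ.+ j) *Q invQ d)         ≈⟨ embQ-* (qfact (i ℕ.+ j)) (invQ d) ⟩
  embQ (qfact (i ℕ.+ j)) S.* embQ (invQ d) ≈⟨ S.*-cong {embQ (qfact (i ℕ.+ j))} {fact (i ℕ.+ j)} {embQ (invQ d)} {fact⁻¹ i S.* fact⁻¹ j}
                                                (embQ-qfact (i ℕ.+ j)) denominator ⟩
  gauss i j                                ∎
  where
  d : QSer
  d = qfact i *Q qfact j
  unfold : qbinom (i ℕ.+ j) i ≡ qfact (i ℕ.+ j) *Q invQ d
  unfold = ≡.trans
    (≡.cong (λ b → if b then qfact (i ℕ.+ j) *Q invQ (qfact i *Q qfact (i ℕ.+ j ∸ i)) else (λ _ → + 0))
      (dec-true (i ≤? i ℕ.+ j) (ℕₚ.m≤m+n i j)))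
    (≡.cong (λ m → qfact (i ℕ.+ j) *Q invQ (qfact i *Q qfact m)) (ℕₚ.m+n∸m≡n i j))
  embQ-d : embQ d ≈S fact i S.* fact j
  embQ-d = begin
    embQ d                                ≈⟨ embQ-* (qfact i) (qfact j) ⟩
    embQ (qfact i) S.* embQ (qfact j)     ≈⟨ S.*-cong {embQ (qfact i)} {fact i} {embQ (qfact j)} {fact j}
                                               (embQ-qfact i) (embQ-qfact j) ⟩
    fact i S.* fact j                     ∎
  denominator : embQ (invQ d) ≈S fact⁻¹ i S.* fact⁻¹ j
  denominator = product-inverse {fact i} {fact⁻¹ i} {fact j} {fact⁻¹ j} {embQ (invQ d)}
    (fact-inverse i) (fact-inverse j) (begin
      fact i S.* fact j S.* embQ (invQ d)   ≈⟨ S.*-congʳ {embQ (invQ d)} {embQ d} {fact i S.* fact j} embQ-d ⟨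
      embQ d S.* embQ (invQ d)              ≈⟨ embQ-inverse d (≡.cong₂ ℤ._*_ (qfact-zero i) (qfact-zero j)) ⟩
      S.1#                                  ∎)

mono-one : mono 0 0 ≈S S.1#
mono-one zero    zero    = ≡.refl
mono-one zero    (suc j) = ≡.refl
mono-one (suc i) zero    = ≡.refl
mono-one (suc i) (suc j) = ≡.refl

mono-q : ∀ a b → mono (suc a) b ≈S q S.* mono a b
mono-q a b zero    j = ≡.sym (QZPS.X⊗-zero (mono a b) j)
mono-q a b (suc i) j = ≡.sym (QZPS.X⊗-suc (mono a b) i j)

mono-z : ∀ b → mono 0 (suc b) ≈S z S.* mono 0 b
mono-z b i j = ≡.sym (≡.trans (QZPS.constant⊗ QPS.X (mono 0 b) i j) (at j))
  where
  off : ∀ i b → (if (i ℕ.≡ᵇ 0) ∧ false then + 1 else + 0) ≡ + 0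
  off zero    b = ≡.refl
  off (suc i) b = ≡.refl
  at : ∀ j → ℤDiag.diag j (λ c d → QPS.X c ℤ.* mono 0 b i d) ≡ mono 0 (suc b) i j
  at zero    = ≡.trans (QPS.X⊗-zero (mono 0 b i)) (≡.sym (off i b))
  at (suc j) = QPS.X⊗-suc (mono 0 b i) j

mono-powers : ∀ a b → mono a b ≈S q ^ a S.* z ^ b
mono-powers zero    zero    = begin
  mono 0 0       ≈⟨ mono-one ⟩
  S.1#           ≈⟨ S.*-identityˡ S.1# ⟨
  S.1# S.* S.1#  ∎
mono-powers zero    (suc b) = begin
  mono 0 (suc b)               ≈⟨ mono-z b ⟩
  z S.* mono 0 b               ≈⟨ S.*-congˡ {z} {mono 0 b} {S.1# S.* z ^ b} (mono-powers 0 b) ⟩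
  z S.* (S.1# S.* z ^ b)       ≈⟨ S.*-congˡ {z} {S.1# S.* z ^ b} {z ^ b} (S.*-identityˡ (z ^ b)) ⟩
  z ^ suc b                    ≈⟨ S.*-identityˡ (z ^ suc b) ⟨
  S.1# S.* z ^ suc b           ∎
mono-powers (suc a) b       = begin
  mono (suc a) b               ≈⟨ mono-q a b ⟩
  q S.* mono a b               ≈⟨ S.*-congˡ {q} {mono a b} {q ^ a S.* z ^ b} (mono-powers a b) ⟩
  q S.* (q ^ a S.* z ^ b)      ≈⟨ S.*-assoc q (q ^ a) (z ^ b) ⟨
  q ^ suc a S.* z ^ b          ∎

-- The zero-based pattern and the final statement

Unique-⊆-↭ : ∀ {xs ys : List ℕ} → Unique xs → All (_∈ ys) xs → length xs ≡ length ys → xs ↭ ys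
Unique-⊆-↭ {[]}     {[]} u a l = ↭-refl
Unique-⊆-↭ {x ∷ xs} (x∉ ∷ u) (x∈ ∷ a) l with ∈-∃++ x∈
... | ys₁ , ys₂ , ≡.refl = ↭-trans
  (prep x (Unique-⊆-↭ u (All.zipWith (λ (ne , m) → remove ne m) (x∉ , a))
    (ℕₚ.suc-injective (≡.trans l (Permₚ.↭-length (Permₚ.shift x ys₁ ys₂))))))
  (↭-sym (Permₚ.shift x ys₁ ys₂))
  where
  remove : ∀ {y} → x ≢ y → y ∈ ys₁ ++ x ∷ ys₂ → y ∈ ys₁ ++ ys₂
  remove ne m with Permₚ.∈-resp-↭ (Permₚ.shift x ys₁ ys₂) m
  ... | here e   = contradiction (≡.sym e) ne
  ... | there m′ = m′

-- After the leading 1 come k + 1 distinct values between 2 and k + 2; lowered by 2 they are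
-- distinct and at most k, hence exhaust 0, ..., k.
reduced-tail : ∀ k τ → IsPerm (suc (suc k)) τ → head τ ≡ just 1 →
  Σ[ κ ∈ List ℕ ] (τ ≡ 1 ∷ map (2 ℕ.+_) κ) × (κ ↭ upTo (suc k))
reduced-tail k (.1 ∷ τ′) (len , _ ∷ bounds , (1∉ ∷ u)) ≡.refl = κ , ≡.cong (1 ∷_) τ′≡ , κ↭
  where
  κ : List ℕ
  κ = map (_∸ 2) τ′
  above : ∀ {x} → x ∈ τ′ → 2 ≤ x
  above m = ℕₚ.≤∧≢⇒< (let (l , _) = All.lookup bounds m in l) (All.lookup 1∉ m)
  τ′≡ : τ′ ≡ map (2 ℕ.+_) κ
  τ′≡ = ≡.trans (≡.sym (Listₚ.map-id τ′)) (≡.trans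
    (map-cong-∈ τ′ (λ m → ≡.sym (ℕₚ.m+[n∸m]≡n (above m)))) (Listₚ.map-∘ τ′))
  κ↭ : κ ↭ upTo (suc k)
  κ↭ = Unique-⊆-↭
    (map-Unique (_∸ 2) τ′ (λ i j → ℕₚ.∸-cancelʳ-≡ (above i) (above j)) u)
    (All.tabulate (λ m → let (x , x∈ , e) = ∈-map⁻ (_∸ 2) m in
      ≡.subst (_∈ upTo (suc k)) (≡.sym e) (∈-upTo⁺ (ℕₚ.+-cancelˡ-≤ 2 _ _
        (≡.subst (_≤ 2 ℕ.+ suc k) (≡.cong suc (≡.sym (ℕₚ.m+[n∸m]≡n (above x∈))))
          (s≤s (proj₂ (All.lookup bounds x∈))))))))
    (≡.trans (Listₚ.length-map (_∸ 2) τ′) (≡.trans (ℕₚ.suc-injective len) (≡.sym (Listₚ.length-upTo (suc k)))))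

last-final : ∀ x xs → last (x ∷ xs) ≡ just (final (x ∷ xs))
last-final x []       = ≡.refl
last-final x (y ∷ xs) = last-final y xs

last-lifted : ∀ κ {n} → length κ ≡ suc n → last (1 ∷ map (2 ℕ.+_) κ) ≡ just (2 ℕ.+ final κ)
last-lifted (x ∷ κ) _ = ≡.trans (last-final (2 ℕ.+ x) (map (2 ℕ.+_) κ)) (≡.cong just (final-map (2 ℕ.+_) {x ∷ κ} ≡.refl))

module _ (κ₀ : List ℕ) (k : ℕ) (κ₀-perm : κ₀ ↭ upTo (suc k))
  (tight : Tight (1 ∷ map (2 ℕ.+_) κ₀)) where

  private
    y : Ser
    y = S.1# S.+ (S.- z)

    module Av = Avoidance seriesRing q z y (Inverses.complement seriesRing z) fact⁻¹ fact-inverse κ₀ k κ₀-perm tight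
    open Av using (τ; wt; coeff; c; c≤k; delay; delay-short; delay-long)
    module Sums = ArrangementSums seriesRing

    INM-coeff : ∀ n → INMcoeff τ n ≈S coeff n
    INM-coeff zero    = mono-one
    INM-coeff (suc n) = begin
      INM τ (suc n)                            ≈⟨ terms L ⟩
      Sums.listΣ L (λ σ → z S.* wt σ)          ≈⟨ Av.listΣ-avoiding (suc n) ⟩
      coeff (suc n)                            ∎
      where
      L : List (List ℕ)
      L = filter (λ σ → numMatches τ σ ≟ 0) (perms (suc n))
      weight : ∀ σ → mono (inv σ) (suc (des σ)) ≈S z S.* wt σ
      weight σ = begin
        mono (inv σ) (suc (des σ))             ≈⟨ mono-powers (inv σ) (suc (des σ)) ⟩
        q ^ inv σ S.* (z S.* z ^ des σ)        ≈⟨ S.*-congˡ {q ^ inv σ} {z S.* z ^ des σ} {z ^ des σ S.* z} (S.*-comm z (z ^ des σ)) ⟩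
        q ^ inv σ S.* (z ^ des σ S.* z)        ≈⟨ S.*-assoc (q ^ inv σ) (z ^ des σ) z ⟨
        wt σ S.* z                             ≈⟨ S.*-comm (wt σ) z ⟩
        z S.* wt σ                             ∎
      terms : ∀ xs → foldr (λ σ acc → mono (inv σ) (suc (des σ)) +S acc) zeroS xs ≈S Sums.listΣ xs (λ σ → z S.* wt σ)
      terms []       i j = ≡.refl
      terms (σ ∷ xs) i j = ≡.cong₂ ℤ._+_ (weight σ i j) (terms xs i j)

    zS≈z : zS ≈S z
    zS≈z = begin
      zS              ≈⟨ mono-z 0 ⟩
      z S.* mono 0 0  ≈⟨ S.*-congˡ {z} {mono 0 0} {S.1#} mono-one ⟩
      z S.* S.1#      ≈⟨ S.*-identityʳ z ⟩
      z               ∎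

    1-z : oneS -S zS ≈S y
    1-z i j = ≡.cong₂ ℤ._-_ (mono-one i j) (zS≈z i j)

    -- A leading minimum takes part in no inversion and no descent, so τ and κ₀ have equal
    -- statistics.
    weight-τ : mono (inv τ) (des τ) ≈S wt κ₀
    weight-τ = begin
      mono (inv τ) (des τ)    ≡⟨ ≡.cong₂ mono inv-τ (des-τ κ₀) ⟩
      mono (inv κ₀) (des κ₀)  ≈⟨ mono-powers (inv κ₀) (des κ₀) ⟩
      wt κ₀                   ∎
      where
      mono-2+ : ∀ w → PreservesOrder (2 ℕ.+_) w
      mono-2+ w _ _ = ≡.refl
      inv-τ : inv τ ≡ inv κ₀
      inv-τ = ≡.cong₂ ℕ._+_ (countLess-above 1 (map (2 ℕ.+_) κ₀) (λ m →
        let (_ , _ , e) = ∈-map⁻ (2 ℕ.+_) m in ≡.subst (1 <_) (≡.sym e) (s≤s (s≤s z≤n))))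
        (inv-map (2 ℕ.+_) κ₀ (mono-2+ κ₀))
      des-τ : ∀ κ → des (1 ∷ map (2 ℕ.+_) κ) ≡ des κ
      des-τ []      = ≡.refl
      des-τ (x ∷ κ) = des-map (2 ℕ.+_) (x ∷ κ) (mono-2+ (x ∷ κ))

    *S-cong : ∀ {f f′ g g′} → f ≈S f′ → g ≈S g′ → f *S g ≈S f′ S.* g′
    *S-cong {f} {f′} {g} {g′} d e = begin
      f *S g     ≈⟨ *S≈* f g ⟩
      f S.* g    ≈⟨ S.*-cong {f} {f′} {g} {g′} d e ⟩
      f′ S.* g′  ∎

  recurrence : ∀ IU → IsReciprocal τ IU →
    (IU 1 ≈S zeroS -S zS)
    × (∀ n → 2 ≤ n → n < suc (suc k) → IU n ≈S (oneS -S zS) *S IU (n ∸ 1))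
    × (∀ n → suc (suc k) ≤ n →
         IU n ≈S (oneS -S zS) *S IU (n ∸ 1)
                  -S mono (inv τ) (des τ) *S embQ (qbinom (n ∸ (2 ℕ.+ c)) (suc (suc k) ∸ (2 ℕ.+ c))) *S IU (suc (n ∸ suc (suc k))))
  recurrence IU (IU-zero , IU-sum) = first , before , after
    where
    reciprocal : ∀ n → SDiag.diag (suc n) (λ i j → gauss i j S.* coeff i S.* IU j) ≈S S.0#
    reciprocal n = begin
      SDiag.diag (suc n) F                               ≈⟨ SDiag.partial-diag (suc n) F ⟨
      SDiag.partial (suc n) (λ i → F i (suc n ∸ i))      ≈⟨ SDiag.partial-cong (suc n) term ⟨
      SDiag.partial (suc n) (λ i → embQ (qbinom (suc n) i) *S INMcoeff τ i *S IU (suc n ∸ i)) ≈⟨ sumS-partial (suc n) _ ⟨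
      sumS (suc n) (λ i → embQ (qbinom (suc n) i) *S INMcoeff τ i *S IU (suc n ∸ i)) ≈⟨ IU-sum (suc n) (s≤s z≤n) ⟩
      S.0# ∎
      where
      F : ℕ → ℕ → Ser
      F i j = gauss i j S.* coeff i S.* IU j
      term : ∀ i → i ≤ suc n → embQ (qbinom (suc n) i) *S INMcoeff τ i *S IU (suc n ∸ i) ≈S F i (suc n ∸ i)
      term i l = *S-cong (*S-cong binomial (INM-coeff i)) (S.refl {IU (suc n ∸ i)})
        where
        binomial : embQ (qbinom (suc n) i) ≈S gauss i (suc n ∸ i)
        binomial = ≡.subst (λ m → embQ (qbinom m i) ≈S gauss i (suc n ∸ i)) (ℕₚ.m+[n∸m]≡n l)
                           (qbinom-gauss i (suc n ∸ i))

    open Av.Reciprocal IU (S.trans {IU 0} {oneS} {S.1#} IU-zero mono-one) reciprocal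

    first : IU 1 ≈S zeroS -S zS
    first i j = ≡.trans
      (Inverses.move-summand seriesRing {S.0#} {IU 1} {z} (S.sym {IU 1 S.+ z} {S.0#} U-one) i j)
      (≡.cong (ℤ._-_ (+ 0)) (≡.sym (zS≈z i j)))

    before : ∀ n → 2 ≤ n → n < suc (suc k) → IU n ≈S (oneS -S zS) *S IU (n ∸ 1)
    before (suc zero) (s≤s ()) _
    before (suc (suc m)) _ (s≤s (s≤s m<k)) = begin
      IU (suc (suc m))             ≈⟨ Inverses.zero-summand seriesRing {y S.* IU (suc m)} {IU (suc (suc m))} {delay k step m}
                                        (U-recurrence m) (delay-short step m<k) ⟩
      y S.* IU (suc m)             ≈⟨ *S-cong 1-z (S.refl {IU (suc m)}) ⟨
      (oneS -S zS) *S IU (suc m)   ∎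

    after : ∀ n → suc (suc k) ≤ n →
         IU n ≈S (oneS -S zS) *S IU (n ∸ 1)
                  -S mono (inv τ) (des τ) *S embQ (qbinom (n ∸ (2 ℕ.+ c)) (suc (suc k) ∸ (2 ℕ.+ c))) *S IU (suc (n ∸ suc (suc k)))
    after (suc (suc m)) (s≤s (s≤s k≤m)) i j = ≡.trans
      (Inverses.move-summand seriesRing {y S.* IU (suc m)} {IU (suc (suc m))} {delay k step m} (U-recurrence m) i j)
      (≡.cong₂ ℤ._-_ (≡.sym (*S-cong 1-z (S.refl {IU (suc m)}) i j)) (delayed i j))
      where
      d : ℕ
      d = m ∸ k
      -- For n = m + 2 this reads (p - s) + (n - p) = n - s.
      upper : (k ∸ c) ℕ.+ d ≡ m ∸ c
      upper = ≡.trans (≡.sym (ℕₚ.+-∸-comm d c≤k)) (≡.cong (_∸ c) (ℕₚ.m+[n∸m]≡n k≤m))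
      binomial : embQ (qbinom (m ∸ c) (k ∸ c)) ≈S gauss d (k ∸ c)
      binomial = begin
        embQ (qbinom (m ∸ c) (k ∸ c))            ≡⟨ ≡.cong (λ l → embQ (qbinom l (k ∸ c))) upper ⟨
        embQ (qbinom ((k ∸ c) ℕ.+ d) (k ∸ c))    ≈⟨ qbinom-gauss (k ∸ c) d ⟩
        gauss (k ∸ c) d                          ≈⟨ gauss-comm (k ∸ c) d ⟩
        gauss d (k ∸ c)                          ∎
      delayed : delay k step m ≈S mono (inv τ) (des τ) *S embQ (qbinom (m ∸ c) (k ∸ c)) *S IU (suc d)
      delayed = begin
        delay k step m                                   ≡⟨ ≡.cong (delay k step) (ℕₚ.m∸n+n≡m k≤m) ⟨
        delay k step (d ℕ.+ k)                           ≡⟨ delay-long k d step ⟩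
        wt κ₀ S.* (gauss d (k ∸ c) S.* IU (suc d))       ≈⟨ S.*-assoc (wt κ₀) (gauss d (k ∸ c)) (IU (suc d)) ⟨
        wt κ₀ S.* gauss d (k ∸ c) S.* IU (suc d)         ≈⟨ *S-cong (*S-cong weight-τ binomial) (S.refl {IU (suc d)}) ⟨
        mono (inv τ) (des τ) *S embQ (qbinom (m ∸ c) (k ∸ c)) *S IU (suc d) ∎

theorem4p1 : (p s : ℕ) (τ : List ℕ) →
    3 ≤ p → IsPerm p τ → head τ ≡ just 1 → last τ ≡ just s →
    2 ≤ s → s < p → MinimalOverlapping p τ →
    (IU : ℕ → Ser) → IsReciprocal τ IU →
    (IU 1 ≈S zeroS -S zS)
    × (∀ n → 2 ≤ n → n < p →
    IU n ≈S (oneS -S zS) *S IU (n ∸ 1))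
    × (∀ n → p ≤ n →
    IU n ≈S (oneS -S zS) *S IU (n ∸ 1)
    -S mono (inv τ) (des τ) *S embQ (qbinom (n ∸ s) (p ∸ s)) *S IU (suc (n ∸ p)))
theorem4p1 (suc zero) s τ (s≤s ())
theorem4p1 (suc (suc k)) s τ _ τ-perm τ-head τ-last _ _ (_ , tight) IU IU-reciprocal
  with reduced-tail k τ τ-perm τ-head
... | κ₀ , ≡.refl , κ₀-perm
  -- The last value of τ is both s and 2 + `final κ₀`, which identifies s with c + 2.
  with ≡.refl ← Maybeₚ.just-injective (≡.trans (≡.sym τ-last) (last-lifted κ₀ (↭-upTo-length κ₀-perm)))
  = recurrence κ₀ k κ₀-perm (λ i σ l → tight i σ (≡.subst (λ p → i < p ℕ.+ p ∸ 1) (proj₁ τ-perm) l)) IU IU-reciprocal
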